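{- Fix integers $n\ge 1$ and $0\le m\le N$, where $N=\binom{n}{2}$. For every integer $i\ge 1$ there exist rational numbers $c_1,\dots,c_i$ (depending on $n,m,i$) such that \[ \Delta_i=\sum_{j=1}^{i} c_j\,\Delta_1^{\,j}; \] that is, $\Delta_i$ can be written in terms of $\Delta_1$ alone (with no identity term).
   Context: All graphs are simple. For a graph $G$ on a fixed set of $n$ vertices with $m$ edges, $N=\binom{n}{2}$. For $j\ge 0$, the modified $j$-deck $MD_j(G)$ is the multiset of graphs $G-X+Y$ where $X$ ranges over all $j$-subsets of $E(G)$ and $Y$ over all $j$-subsets of the set of non-edges of $G-X$ (i.e. $j$ edges are removed in all possible ways and then $j$ edges, not necessarily new, are added in all possible ways). Let $G_1,G_2,\dots$ represent the isomorphism classes of graphs with $n$ vertices and $m$ edges. $\Delta_j$ is the square matrix whose $(k,l)$ entry is the number of members of $MD_j(G_l)$ isomorphic to $G_k$; products are matrix products. -}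

module Defs where

open import Data.Bool using (Bool; true; false; _∧_; _∨_; not; if_then_else_)
open import Data.Nat using (ℕ; zero; suc)
open import Data.Fin using (Fin; zero; suc; toℕ; _≟_; _<?_)
open import Data.List using (List; []; _∷_; map; concatMap; allFin; cartesianProduct)
open import Data.Bool.ListAction using (all; any)
open import Data.Product using (_×_; _,_; ∃)
open import Data.Integer using (+_)
open import Data.Rational using (ℚ; 0ℚ; _+_; _*_; _/_)
open import Relation.Nullary using (does)
open import Relation.Binary.PropositionalEquality using (_≡_)

Graph : ℕ → Set
Graph n = Fin n → Fin n → Bool

_==_ : ∀ {n} → Fin n → Fin n → Bool
a == b = does (a ≟ b)

_<ᵇ_ : ∀ {n} → Fin n → Fin n → Bool
a <ᵇ b = does (a <? b)

record Simple {n : ℕ} (G : Graph n) : Set where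
  field
    symmetric   : ∀ a b → G a b ≡ G b a
    irreflexive : ∀ a → G a a ≡ false

slots : ∀ n → List (Fin n × Fin n)
slots n = concatMap (λ a → concatMap (λ b → if a <ᵇ b then (a , b) ∷ [] else []) (allFin n)) (allFin n)

count : ∀ {A : Set} → (A → Bool) → List A → ℕ
count p []       = zero
count p (x ∷ xs) = if p x then suc (count p xs) else count p xs

edges : ∀ {n} → Graph n → ℕ
edges {n} G = count (λ { (a , b) → G a b }) (slots n)

addEdge : ∀ {n} → Graph n → Fin n → Fin n → Graph n
addEdge G a b x y = ((x == a) ∧ (y == b)) ∨ ((x == b) ∧ (y == a)) ∨ G x y

-- all simple graphs on Fin n, each listed exactly once (one per edge set)
graphsOn : ∀ {n} → List (Fin n × Fin n) → List (Graph n)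
graphsOn []            = (λ _ _ → false) ∷ []
graphsOn ((a , b) ∷ s) = concatMap (λ G → G ∷ addEdge G a b ∷ []) (graphsOn s)

graphs : ∀ n → List (Graph n)
graphs n = graphsOn (slots n)

maps : ∀ k n → List (Fin k → Fin n)
maps zero    n = (λ ()) ∷ []
maps (suc k) n = concatMap (λ b → map (λ f → λ { zero → b ; (suc x) → f x }) (maps k n)) (allFin n)

injective? : ∀ {n} → (Fin n → Fin n) → Bool
injective? {n} σ = all (λ a → all (λ b → not (σ a == σ b) ∨ (a == b)) (allFin n)) (allFin n)

_≅?_ : ∀ {n} → Graph n → Graph n → Bool
_≅?_ {n} G H = any (λ σ → injective? σ ∧
                      all (λ a → all (λ b → does (Data.Bool._≟_ (G a b) (H (σ a) (σ b)))) (allFin n)) (allFin n))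
                   (maps n n)
  where import Data.Bool

_─_⊕_ : ∀ {n} → Graph n → Graph n → Graph n → Graph n
(G ─ X ⊕ Y) a b = (G a b ∧ not (X a b)) ∨ Y a b

_⊆?_ : ∀ {n} → Graph n → Graph n → Bool
_⊆?_ {n} X G = all (λ { (a , b) → not (X a b) ∨ G a b }) (slots n)

disjoint? : ∀ {n} → Graph n → Graph n → Bool
disjoint? {n} X G = all (λ { (a , b) → not (X a b ∧ G a b) }) (slots n)

-- number of members of MD_j(G) isomorphic to H:
-- pairs (X , Y) with X a j-subset of E(G) and Y a j-subset of the
-- non-edges of G - X, such that G - X + Y ≅ H.
deckCount : ∀ {n} → ℕ → Graph n → Graph n → ℕ
deckCount {n} j G H =
  count (λ { (X , Y) → (X ⊆? G) ∧ does (Data.Nat._≟_ (edges X) j)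
                     ∧ disjoint? Y (λ a b → G a b ∧ not (X a b))
                     ∧ does (Data.Nat._≟_ (edges Y) j)
                     ∧ ((G ─ X ⊕ Y) ≅? H) })
        (cartesianProduct (graphs n) (graphs n))
  where import Data.Nat

Matrix : ℕ → Set
Matrix k = Fin k → Fin k → ℚ

ℕ→ℚ : ℕ → ℚ
ℕ→ℚ x = (+ x) / 1

sumℚ : ∀ {k} → (Fin k → ℚ) → ℚ
sumℚ {zero}  f = 0ℚ
sumℚ {suc k} f = f zero + sumℚ (λ x → f (suc x))

_⊗_ : ∀ {k} → Matrix k → Matrix k → Matrix k
(A ⊗ B) x y = sumℚ (λ z → A x z * B z y)

_^[1+_] : ∀ {k} → Matrix k → ℕ → Matrix k
A ^[1+ zero  ] = A
A ^[1+ suc p ] = A ⊗ (A ^[1+ p ])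

Δ : ∀ {n k} → (Fin k → Graph n) → ℕ → Matrix k
Δ reps j x y = ℕ→ℚ (deckCount j (reps y) (reps x))

record IsoClassEnum (n m : ℕ) {k : ℕ} (reps : Fin k → Graph n) : Set where
  field
    simple   : ∀ x → Simple (reps x)
    size     : ∀ x → edges (reps x) ≡ m
    distinct : ∀ x y → (reps x ≅? reps y) ≡ true → x ≡ y
    complete : ∀ (G : Graph n) → Simple G → edges G ≡ m →
               ∃ (λ x → (G ≅? reps x) ≡ true)

{-# OPTIONS --safe #-}
-- On functions of a labelled graph let D_j sum over the removals of j edges and U_j over the
-- additions of j edges, so that the j-move counts are D_j U_j. With e the number of edges and e'
-- the number of non-edges of the graph,
--   U_{j+1} D_1 = D_1 U_{j+1} + (e' - e - j) U_j ,  D_j D_1 = (j+1) D_{j+1} ,  U_j U_1 = (j+1) U_{j+1} ,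
-- which give, for j ≥ 1, Δ_1 Δ_j = (j+1)² Δ_{j+1} + j (N - 2m + j + 1) Δ_j. This expresses Δ_{j+1}
-- through Δ_1 Δ_j and Δ_j, and no constant term ever arises. The passage from labelled graphs to
-- isomorphism classes rests on the isomorphism invariance of the number of 1-moves into a class.
module Submission where

open import Defs
open import Algebra.Bundles using (module CommutativeRing)
open import Data.Bool using (Bool; true; false; not; _∧_; _∨_; if_then_else_; _≟_; T)
open import Data.Bool.ListAction using (all)
open import Data.Bool.Properties using (T-≡; T-∧; ∧-comm; ∧-zeroʳ; ∧-identityʳ; ∨-comm; ∨-zeroʳ; ∨-identityʳ)
open import Data.Fin as Fin using (Fin; zero; suc; toℕ)
open import Data.Fin.Permutation using (Permutation; permutation)
import Data.Fin.Properties as Fin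
import Data.Integer as ℤ
import Data.Integer.Properties as ℤ
open import Data.List as List using (List; []; _∷_; _++_; map; concatMap; cartesianProduct; length; allFin)
open import Data.List.Membership.Propositional using (_∈_; _∉_)
open import Data.List.Membership.Propositional.Properties using (∈-allFin; ∈-lookup; ∈-concatMap⁺; ∈-concatMap⁻)
open import Data.List.Relation.Unary.All as All using (All; []; _∷_)
import Data.List.Relation.Unary.All.Properties as All
open import Data.List.Relation.Unary.AllPairs as AllPairs using ([]; _∷_)
import Data.List.Relation.Unary.AllPairs.Properties as AllPairs
open import Data.List.Relation.Unary.Any as Any using (Any; here; there)
import Data.List.Relation.Unary.Any.Properties as Any
open import Data.List.Relation.Unary.Unique.Propositional using (Unique)
import Data.List.Relation.Unary.Unique.Propositional.Properties as Unique
open import Data.Nat as ℕ using (ℕ; zero; suc; _≤_; _≥_)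
open import Data.Nat.Combinatorics using (_C_)
import Data.Nat.Properties as ℕ
open import Data.Product using (_×_; _,_; proj₁; proj₂; ∃)
open import Data.Rational as ℚ using (ℚ; 0ℚ; 1ℚ; ½; 1/_; _+_; _*_; _-_; -_; toℚᵘ; ≢-nonZero)
open import Data.Rational.Properties hiding (_≟_)
open import Data.Rational.Solver using (module +-*-Solver)
open import Data.Rational.Unnormalised as ℚᵘ using (mkℚᵘ)
import Data.Rational.Unnormalised.Properties as ℚᵘ
open import Data.Unit using (tt)
open import Data.Vec as Vec using (Vec; []; _∷_; lookup; zipWith; _[_]≔_)
open import Function using (_∘_; Equivalence)
open import Relation.Binary using (tri<; tri≈; tri>)
open import Relation.Binary.PropositionalEquality
open import Relation.Nullary using (Dec; does; yes; no; contradiction)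
open import Relation.Nullary.Decidable using (dec-true; dec-false)
import Algebra.Properties.Monoid.Mult +-0-monoid as Mult
open import Algebra.Properties.Semiring.Sum (CommutativeRing.semiring +-*-commutativeRing) using (sum; sum-cong-≗; sum-permute; sum-replicate-zero; ∑-comm; ∑-distrib-+; *-distribˡ-sum)
open +-*-Solver using (solve; _:=_; _:+_; _:*_; _:-_; :-_; con)

-- The correction in the commutation rule comes from edges touched twice. In U_{j+1} D_1 the removed
-- edge may be a newly added one, and then each set of j added edges arises e' - j times; in D_1
-- U_{j+1} the removed edge may be added back, and then each such set arises e times. All other
-- choices match. The rule is applied to the graph left after the j removals of Δ_j. There e' - e
-- has grown from N - 2m to N - 2m + 2j, which is the source of the + j + 1 in the recurrence. The
-- matrix product sums over representatives of classes, while the operators pass through arbitrary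
-- labelled graphs. In Δ_1 Δ_j the 1-move comes last, so only its count has to be carried from a
-- labelled intermediate graph to the representative of its class. Invariance of single moves
-- therefore suffices.

private variable
  N n : ℕ
  A B : Set

-- Unlike ℕ→ℚ, which normalises a fraction, ι (suc n) unfolds to 1ℚ + ι n.
ι : ℕ → ℚ
ι n = n Mult.× 1ℚ

ℕ→ℚ-homo-+ : ∀ x y → ℕ→ℚ (x ℕ.+ y) ≡ ℕ→ℚ x + ℕ→ℚ y
ℕ→ℚ-homo-+ x y = toℚᵘ-injective (begin-equality
  toℚᵘ (ℕ→ℚ (x ℕ.+ y))            ≃⟨ toℚᵘ-fromℚᵘ (q (x ℕ.+ y)) ⟩
  q (x ℕ.+ y)                     ≃⟨ ℚᵘ.*≡* (cong (ℤ._* ℤ.1ℤ) (sym (cong₂ ℤ._+_ (ℤ.*-identityʳ (ℤ.+ x)) (ℤ.*-identityʳ (ℤ.+ y))))) ⟩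
  q x ℚᵘ.+ q y                    ≃⟨ ℚᵘ.+-cong (ℚᵘ.≃-sym (toℚᵘ-fromℚᵘ (q x))) (ℚᵘ.≃-sym (toℚᵘ-fromℚᵘ (q y))) ⟩
  toℚᵘ (ℕ→ℚ x) ℚᵘ.+ toℚᵘ (ℕ→ℚ y)  ≃⟨ ℚᵘ.≃-sym (toℚᵘ-homo-+ (ℕ→ℚ x) (ℕ→ℚ y)) ⟩
  toℚᵘ (ℕ→ℚ x + ℕ→ℚ y)            ∎)
  where
  open ℚᵘ.≤-Reasoning
  q : ℕ → ℚᵘ.ℚᵘ
  q z = mkℚᵘ (ℤ.+ z) 0

ι≡ℕ→ℚ : ∀ n → ι n ≡ ℕ→ℚ n
ι≡ℕ→ℚ zero    = refl
ι≡ℕ→ℚ (suc n) = trans (cong (1ℚ +_) (ι≡ℕ→ℚ n)) (sym (ℕ→ℚ-homo-+ 1 n))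

-- Changing entries of a Boolean vector: the operators and their commutation relations

⟦_⟧ : Bool → ℚ
⟦ b ⟧ = if b then 1ℚ else 0ℚ

⟦∧⟧ : ∀ a b → ⟦ a ∧ b ⟧ ≡ ⟦ a ⟧ * ⟦ b ⟧
⟦∧⟧ false b = sym (*-zeroˡ ⟦ b ⟧)
⟦∧⟧ true  b = sym (*-identityˡ ⟦ b ⟧)

⟦not≟⟧ : ∀ b → ⟦ does (not b ≟ b) ⟧ ≡ 0ℚ
⟦not≟⟧ false = refl
⟦not≟⟧ true  = refl

-- Sums f over the vectors obtained from v by changing j entries from b to not b:
-- move true j is the D_j and move false j the U_j of the header.
move : Bool → ℕ → (Vec Bool N → ℚ) → Vec Bool N → ℚ
move b zero    f v       = f v
move b (suc j) f []      = 0ℚ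
move b (suc j) f (c ∷ v) = move b (suc j) (f ∘ (c ∷_)) v + ⟦ does (c ≟ b) ⟧ * move b j (f ∘ (not b ∷_)) v

-- Every vector reached has exactly `j` fewer entries `b` and `j` more entries `not b`, so agreement
-- is asked only there. These counts later determine `excess` at intermediate vectors and keep the
-- argument among graphs with m edges.
move-cong : ∀ b j {f g : Vec Bool N → ℚ} v →
  (∀ w → Vec.count (_≟ b) w ℕ.+ j ≡ Vec.count (_≟ b) v → Vec.count (_≟ not b) w ≡ Vec.count (_≟ not b) v ℕ.+ j → f w ≡ g w) →
  move b j f v ≡ move b j g v
move-cong b zero    v f≈g = f≈g v (ℕ.+-identityʳ _) (sym (ℕ.+-identityʳ _))
move-cong b (suc j) [] f≈g = refl
move-cong true (suc j) (true ∷ v) f≈g = cong₂ _+_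
  (move-cong true (suc j) v λ w p q → f≈g (true ∷ w) (cong suc p) q)
  (cong (1ℚ *_) (move-cong true j v λ w p q → f≈g (false ∷ w)
     (trans (ℕ.+-suc _ j) (cong suc p)) (trans (cong suc q) (sym (ℕ.+-suc _ j)))))
move-cong true (suc j) {f} {g} (false ∷ v) f≈g = cong₂ _+_
  (move-cong true (suc j) v λ w p q → f≈g (false ∷ w) p (cong suc q))
  (trans (*-zeroˡ (move true j (f ∘ (false ∷_)) v)) (sym (*-zeroˡ (move true j (g ∘ (false ∷_)) v))))
move-cong false (suc j) (false ∷ v) f≈g = cong₂ _+_
  (move-cong false (suc j) v λ w p q → f≈g (false ∷ w) (cong suc p) q)
  (cong (1ℚ *_) (move-cong false j v λ w p q → f≈g (true ∷ w)
     (trans (ℕ.+-suc _ j) (cong suc p)) (trans (cong suc q) (sym (ℕ.+-suc _ j)))))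
move-cong false (suc j) {f} {g} (true ∷ v) f≈g = cong₂ _+_
  (move-cong false (suc j) v λ w p q → f≈g (true ∷ w) p (cong suc q))
  (trans (*-zeroˡ (move false j (f ∘ (true ∷_)) v)) (sym (*-zeroˡ (move false j (g ∘ (true ∷_)) v))))

move-cong-≗ : ∀ b j {f g : Vec Bool N → ℚ} v → (∀ w → f w ≡ g w) → move b j f v ≡ move b j g v
move-cong-≗ b j v f≈g = move-cong b j v λ w _ _ → f≈g w

move-linear : ∀ b j p (f g : Vec Bool N → ℚ) v →
  move b j (λ w → p * f w + g w) v ≡ p * move b j f v + move b j g v
move-linear b zero    p f g v  = refl
move-linear b (suc j) p f g [] = solve 1 (λ p → con 0ℚ := p :* con 0ℚ :+ con 0ℚ) refl p
move-linear b (suc j) p f g (c ∷ v)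
  rewrite move-linear b (suc j) p (f ∘ (c ∷_)) (g ∘ (c ∷_)) v
        | move-linear b j p (f ∘ (not b ∷_)) (g ∘ (not b ∷_)) v =
  solve 6 (λ p x y e z w → p :* x :+ y :+ e :* (p :* z :+ w) := p :* (x :+ e :* z) :+ (y :+ e :* w)) refl
    p (move b (suc j) (f ∘ (c ∷_)) v) (move b (suc j) (g ∘ (c ∷_)) v) ⟦ does (c ≟ b) ⟧
    (move b j (f ∘ (not b ∷_)) v) (move b j (g ∘ (not b ∷_)) v)

move-0 : ∀ b j (v : Vec Bool N) → move b j (λ _ → 0ℚ) v ≡ 0ℚ
move-0 b zero    v       = refl
move-0 b (suc j) []      = refl
move-0 b (suc j) (c ∷ v) rewrite move-0 b (suc j) v | move-0 b j v =
  solve 1 (λ e → con 0ℚ :+ e :* con 0ℚ := con 0ℚ) refl ⟦ does (c ≟ b) ⟧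

move-scale : ∀ b j p (f : Vec Bool N → ℚ) v → move b j (λ w → p * f w) v ≡ p * move b j f v
move-scale b j p f v = begin
  move b j (λ w → p * f w) v                 ≡⟨ move-cong-≗ b j v (λ w → sym (+-identityʳ _)) ⟩
  move b j (λ w → p * f w + 0ℚ) v            ≡⟨ move-linear b j p f (λ _ → 0ℚ) v ⟩
  p * move b j f v + move b j (λ _ → 0ℚ) v   ≡⟨ cong (p * move b j f v +_) (move-0 b j v) ⟩
  p * move b j f v + 0ℚ                      ≡⟨ +-identityʳ _ ⟩
  p * move b j f v                           ∎
  where open ≡-Reasoning

-- Each set of `suc j` changed entries arises once for every choice of the entry that is changed
-- last.
move-move₁ : ∀ b j (f : Vec Bool N → ℚ) v → move b j (move b 1 f) v ≡ ι (suc j) * move b (suc j) f v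
move-move₁ b zero    f v  = sym (*-identityˡ _)
move-move₁ b (suc j) f [] = sym (*-zeroʳ (ι (suc (suc j))))
move-move₁ b (suc j) f (c ∷ v) = begin
  move b (suc j) (λ w → move b 1 f (c ∷ w)) v + e * move b j (λ w → move b 1 f (not b ∷ w)) v
    ≡⟨ cong₂ (λ x y → x + e * y)
         (trans (move-cong-≗ b (suc j) v λ w → +-comm (move b 1 (f ∘ (c ∷_)) w) _)
                (move-linear b (suc j) e (f ∘ (not b ∷_)) (move b 1 (f ∘ (c ∷_))) v))
         -- A head already changed to `not b` cannot be changed a second time, so that summand
         -- vanishes.
         (move-cong-≗ b j v λ w →
            trans (cong (λ z → move b 1 (f ∘ (not b ∷_)) w + z * f (not b ∷ w)) (⟦not≟⟧ b))
                  (trans (cong (move b 1 (f ∘ (not b ∷_)) w +_) (*-zeroˡ (f (not b ∷ w)))) (+-identityʳ _))) ⟩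
  (e * move b (suc j) (f ∘ (not b ∷_)) v + move b (suc j) (move b 1 (f ∘ (c ∷_))) v) + e * move b j (move b 1 (f ∘ (not b ∷_))) v
    ≡⟨ cong₂ (λ x y → (e * move b (suc j) (f ∘ (not b ∷_)) v + x) + e * y)
         (move-move₁ b (suc j) (f ∘ (c ∷_)) v)
         (move-move₁ b j (f ∘ (not b ∷_)) v) ⟩
  (e * y + (1ℚ + k) * x) + e * (k * y)
    ≡⟨ solve 4 (λ e x y k → (e :* y :+ (con 1ℚ :+ k) :* x) :+ e :* (k :* y) := (con 1ℚ :+ k) :* (x :+ e :* y)) refl e x y k ⟩
  (1ℚ + k) * (x + e * y) ∎
  where
  open ≡-Reasoning
  e = ⟦ does (c ≟ b) ⟧
  k = ι (suc j)
  x = move b (suc (suc j)) (f ∘ (c ∷_)) v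
  y = move b (suc j) (f ∘ (not b ∷_)) v

move-+ : ∀ b j (f : Vec Bool N → ℚ) (g : Vec Bool N → ℚ) v →
  move b j (λ w → f w + g w) v ≡ move b j f v + move b j g v
move-+ b j f g v = begin
  move b j (λ w → f w + g w) v      ≡⟨ move-cong-≗ b j v (λ w → cong (_+ g w) (sym (*-identityˡ (f w)))) ⟩
  move b j (λ w → 1ℚ * f w + g w) v ≡⟨ move-linear b j 1ℚ f g v ⟩
  1ℚ * move b j f v + move b j g v  ≡⟨ cong (_+ move b j g v) (*-identityˡ (move b j f v)) ⟩
  move b j f v + move b j g v       ∎
  where open ≡-Reasoning

-- This is e' - e; it is rational because it can be negative.
excess : Vec Bool N → ℚ
excess v = ι (Vec.count (_≟ false) v) - ι (Vec.count (_≟ true) v)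

move-keep : ∀ b j (f : Vec Bool (suc N) → ℚ) v → move b j f (not b ∷ v) ≡ move b j (f ∘ (not b ∷_)) v
move-keep b     zero    f v = refl
move-keep b     (suc j) f v rewrite ⟦not≟⟧ b = trans (cong (move b (suc j) (f ∘ (not b ∷_)) v +_) (*-zeroˡ (move b j (f ∘ (not b ∷_)) v))) (+-identityʳ _)

excess-true : ∀ (v : Vec Bool N) → excess (true ∷ v) ≡ excess v - 1ℚ
excess-true v =
  solve 2 (λ x y → x :- (con 1ℚ :+ y) := x :- y :- con 1ℚ) refl
    (ι (Vec.count (_≟ false) v)) (ι (Vec.count (_≟ true) v))

excess-false : ∀ (v : Vec Bool N) → excess (false ∷ v) ≡ excess v + 1ℚ
excess-false v =
  solve 2 (λ x y → (con 1ℚ :+ x) :- y := x :- y :+ con 1ℚ) refl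
    (ι (Vec.count (_≟ false) v)) (ι (Vec.count (_≟ true) v))

-- Induction on the vector replaces the counting of sets: each head shifts `excess` by one, and the
-- shift is balanced by the moves that touch this head twice.
move-commute : ∀ j (f : Vec Bool N → ℚ) v →
  move false (suc j) (move true 1 f) v ≡
  move true 1 (move false (suc j) f) v + (excess v - ι j) * move false j f v
move-commute zero f [] = sym (trans (+-identityˡ (0ℚ * f [])) (*-zeroˡ (f [])))
move-commute (suc j) f [] = solve 1 (λ p → con 0ℚ := con 0ℚ :+ p :* con 0ℚ) refl (excess [] - ι (suc j))
move-commute j f (true ∷ v) = begin
  move false (suc j) (move true 1 f) (true ∷ v)
    ≡⟨ move-keep false (suc j) (move true 1 f) v ⟩
  move false (suc j) (λ w → move true 1 f₁ w + 1ℚ * f₀ w) v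
    ≡⟨ move-+ false (suc j) (move true 1 f₁) (λ w → 1ℚ * f₀ w) v ⟩
  move false (suc j) (move true 1 f₁) v + move false (suc j) (λ w → 1ℚ * f₀ w) v
    ≡⟨ cong₂ _+_ (move-commute j f₁ v) (move-scale false (suc j) 1ℚ f₀ v) ⟩
  (x + (t - k) * y) + 1ℚ * z
    -- Removing the head edge and adding it back gives one extra `y` on the right, which offsets the
    -- drop of the excess by 1.
    ≡⟨ solve 5 (λ x t k y z → (x :+ (t :- k) :* y) :+ con 1ℚ :* z :=
         (x :+ con 1ℚ :* (z :+ con 1ℚ :* y)) :+ (t :- con 1ℚ :- k) :* y) refl x t k y z ⟩
  (x + 1ℚ * (z + 1ℚ * y)) + (t - 1ℚ - k) * y
    ≡⟨ cong₂ _+_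
         (cong (_+ 1ℚ * (z + 1ℚ * y)) (sym (move-cong-≗ true 1 v (move-keep false (suc j) f))))
         (cong₂ (λ a b → (a - k) * b) (sym (excess-true v)) (sym (move-keep false j f v))) ⟩
  move true 1 (move false (suc j) f) (true ∷ v) + (excess (true ∷ v) - k) * move false j f (true ∷ v) ∎
  where
  open ≡-Reasoning
  f₀ = f ∘ (false ∷_)
  f₁ = f ∘ (true ∷_)
  x = move true 1 (move false (suc j) f₁) v
  y = move false j f₁ v
  z = move false (suc j) f₀ v
  t = excess v
  k = ι j
move-commute j f (false ∷ v) = begin
  move false (suc j) (λ w → move true 1 f (false ∷ w)) v + 1ℚ * move false j (λ w → move true 1 f₁ w + 1ℚ * f₀ w) v
    ≡⟨ cong₂ (λ a b → a + 1ℚ * b)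
         (trans (move-cong-≗ false (suc j) v (move-keep true 1 f)) (move-commute j f₀ v))
         (trans (move-+ false j (move true 1 f₁) (λ w → 1ℚ * f₀ w) v)
                (cong (move false j (move true 1 f₁) v +_) (move-scale false j 1ℚ f₀ v))) ⟩
  (x + (t - k) * y) + 1ℚ * (move false j (move true 1 f₁) v + 1ℚ * y)
    -- Adding the head edge and removing it again gives the extra `y` on the left, matched by the
    -- rise of the excess by 1.
    ≡⟨ step j ⟩
  (x + 1ℚ * move true 1 (move false j f₁) v) + (t + 1ℚ - k) * move false j f (false ∷ v)
    ≡⟨ cong₂ _+_
         (sym (trans (move-keep true 1 (move false (suc j) f) v)
              (trans (move-+ true 1 (move false (suc j) f₀) (λ w → 1ℚ * move false j f₁ w) v)
                     (cong (x +_) (move-scale true 1 1ℚ (move false j f₁) v)))))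
         (cong (λ a → (a - k) * move false j f (false ∷ v)) (sym (excess-false v))) ⟩
  move true 1 (move false (suc j) f) (false ∷ v) + (excess (false ∷ v) - k) * move false j f (false ∷ v) ∎
  where
  open ≡-Reasoning
  f₀ = f ∘ (false ∷_)
  f₁ = f ∘ (true ∷_)
  x = move true 1 (move false (suc j) f₀) v
  y = move false j f₀ v
  t = excess v
  k = ι j
  -- `move false j` unfolds on `false ∷ v` differently at zero and at a successor. At zero no
  -- further additions remain to be commuted; at a successor the remaining ones are, by the
  -- induction hypothesis on `v` for `f₁`.
  step : ∀ j → let y = move false j f₀ v; k = ι j; x = move true 1 (move false (suc j) f₀) v in
    (x + (t - k) * y) + 1ℚ * (move false j (move true 1 f₁) v + 1ℚ * y) ≡
    (x + 1ℚ * move true 1 (move false j f₁) v) + (t + 1ℚ - k) * move false j f (false ∷ v)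
  step zero = solve 5 (λ x t k y z → (x :+ (t :- k) :* y) :+ con 1ℚ :* (z :+ con 1ℚ :* y) :=
      (x :+ con 1ℚ :* z) :+ (t :+ con 1ℚ :- k) :* y) refl
    (move true 1 (move false 1 f₀) v) t (ι 0) (f₀ v) (move true 1 f₁ v)
  step (suc j) rewrite move-commute j f₁ v =
    solve 6 (λ x t k y z w →
      (x :+ (t :- (con 1ℚ :+ k)) :* y) :+ con 1ℚ :* ((z :+ (t :- k) :* w) :+ con 1ℚ :* y) :=
      (x :+ con 1ℚ :* z) :+ (t :+ con 1ℚ :- (con 1ℚ :+ k)) :* (y :+ con 1ℚ :* w)) refl
      (move true 1 (move false (suc (suc j)) f₀) v) t (ι j) (move false (suc j) f₀ v)
      (move true 1 (move false (suc j) f₁) v) (move false j f₁ v)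

swap : ℕ → (Vec Bool N → ℚ) → Vec Bool N → ℚ
swap j f = move true j (move false j f)

-- The recurrence on labelled graphs. One factor `ι (suc (suc j))` comes from merging removals and
-- the other from merging additions.
swap-swap₁ : ∀ j (f : Vec Bool N → ℚ) v →
  swap (suc j) (swap 1 f) v ≡
  ι (suc (suc j)) * ι (suc (suc j)) * swap (suc (suc j)) f v +
  ι (suc j) * (excess v + ι (suc (suc j))) * swap (suc j) f v
swap-swap₁ j f v = begin
  move true (suc j) (move false (suc j) (move true 1 (move false 1 f))) v
    ≡⟨ move-cong true (suc j) v (λ w p q → trans (move-commute j (move false 1 f) w)
         (trans (cong₂ (λ a b → a + (b - ι j) * move false j (move false 1 f) w)
            (trans (move-cong-≗ true 1 w (move-move₁ false (suc j) f)) (move-scale true 1 K₂ (move false (suc (suc j)) f) w))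
            (shift w p q))
          (trans (cong (λ a → K₂ * move true 1 (move false (suc (suc j)) f) w + (excess v + (K₁ + K₁) - ι j) * a)
              (move-move₁ false j f w))
            (cong (K₂ * move true 1 (move false (suc (suc j)) f) w +_) (sym (*-assoc (excess v + (K₁ + K₁) - ι j) K₁ (move false (suc j) f w))))))) ⟩
  move true (suc j) (λ w → K₂ * move true 1 (move false (suc (suc j)) f) w + (excess v + (K₁ + K₁) - ι j) * K₁ * move false (suc j) f w) v
    ≡⟨ move-linear true (suc j) K₂ (move true 1 (move false (suc (suc j)) f)) (λ w → (excess v + (K₁ + K₁) - ι j) * K₁ * move false (suc j) f w) v ⟩
  K₂ * move true (suc j) (move true 1 (move false (suc (suc j)) f)) v + move true (suc j) (λ w → (excess v + (K₁ + K₁) - ι j) * K₁ * move false (suc j) f w) v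
    ≡⟨ cong₂ (λ a b → K₂ * a + b)
        (move-move₁ true (suc j) (move false (suc (suc j)) f) v)
        (move-scale true (suc j) ((excess v + (K₁ + K₁) - ι j) * K₁) (move false (suc j) f) v) ⟩
  K₂ * (K₂ * swap (suc (suc j)) f v) + (excess v + (K₁ + K₁) - ι j) * K₁ * swap (suc j) f v
    ≡⟨ cong₂ _+_ (sym (*-assoc K₂ K₂ (swap (suc (suc j)) f v))) (cong (_* swap (suc j) f v) coef) ⟩
  K₂ * K₂ * swap (suc (suc j)) f v + K₁ * (excess v + K₂) * swap (suc j) f v ∎
  where
  open ≡-Reasoning
  K₁ = ι (suc j)
  K₂ = ι (suc (suc j))
  -- Each of the `suc j` removals turns an edge into a non-edge and so raises the excess by 2.
  shift : ∀ w → Vec.count (_≟ true) w ℕ.+ suc j ≡ Vec.count (_≟ true) v → Vec.count (_≟ false) w ≡ Vec.count (_≟ false) v ℕ.+ suc j →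
          excess w ≡ excess v + (K₁ + K₁)
  shift w p q rewrite sym p | q | Mult.×-homo-+ 1ℚ (Vec.count (_≟ false) v) (suc j) | Mult.×-homo-+ 1ℚ (Vec.count (_≟ true) w) (suc j) =
    solve 3 (λ a b k → a :+ k :- b := a :- (b :+ k) :+ (k :+ k)) refl (ι (Vec.count (_≟ false) v)) (ι (Vec.count (_≟ true) w)) K₁
  coef : (excess v + (K₁ + K₁) - ι j) * K₁ ≡ K₁ * (excess v + K₂)
  coef =
    solve 2 (λ t k → (t :+ ((con 1ℚ :+ k) :+ (con 1ℚ :+ k)) :- k) :* (con 1ℚ :+ k) := (con 1ℚ :+ k) :* (t :+ (con 1ℚ :+ (con 1ℚ :+ k)))) refl (excess v) (ι j)

-- Graphs as Boolean vectors over the slots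

sumVec : ∀ N → (Vec Bool N → ℚ) → ℚ
sumVec zero    f = f []
sumVec (suc N) f = sumVec N (λ x → f (false ∷ x) + f (true ∷ x))

sumVec-cong : ∀ N {f g : Vec Bool N → ℚ} → (∀ x → f x ≡ g x) → sumVec N f ≡ sumVec N g
sumVec-cong zero    f≈g = f≈g []
sumVec-cong (suc N) f≈g = sumVec-cong N λ x → cong₂ _+_ (f≈g (false ∷ x)) (f≈g (true ∷ x))

sumVec-linear : ∀ N p (f g : Vec Bool N → ℚ) → sumVec N (λ x → f x + p * g x) ≡ sumVec N f + p * sumVec N g
sumVec-linear zero    p f g = refl
sumVec-linear (suc N) p f g = trans
  (sumVec-cong N λ x → solve 5 (λ p a b c d → (a :+ p :* b) :+ (c :+ p :* d) := (a :+ c) :+ p :* (b :+ d)) refl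
    p (f (false ∷ x)) (g (false ∷ x)) (f (true ∷ x)) (g (true ∷ x)))
  (sumVec-linear N p _ _)

sumVec-scale : ∀ N p (f : Vec Bool N → ℚ) → sumVec N (λ x → p * f x) ≡ p * sumVec N f
sumVec-scale zero    p f = refl
sumVec-scale (suc N) p f = trans
  (sumVec-cong N λ x → sym (*-distribˡ-+ p (f (false ∷ x)) (f (true ∷ x))))
  (sumVec-scale N p _)

-- One test serves both deck conditions: at `true` the chosen positions are edges, at `false` they
-- are non-edges.
within : Bool → Vec Bool N → Vec Bool N → Bool
within b []      []      = true
within b (x ∷ xs) (c ∷ v) = (not x ∨ does (c ≟ b)) ∧ within b xs v

toggle : Bool → Vec Bool N → Vec Bool N → Vec Bool N
toggle b = zipWith (λ x c → if x then not b else c)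

card : Vec Bool N → ℕ
card = Vec.count (_≟ true)

-- The recursive form of `move` suits the algebra; this form, a sum over all sets of positions, is
-- the one in which `deckCount` enumerates.
move≡sum : ∀ b j (f : Vec Bool N → ℚ) v →
  move b j f v ≡ sumVec N (λ x → ⟦ within b x v ⟧ * (⟦ does (card x ℕ.≟ j) ⟧ * f (toggle b x v)))
move≡sum b zero    f [] = sym (trans (*-identityˡ _) (*-identityˡ (f [])))
move≡sum b (suc j) f [] = sym (trans (*-identityˡ _) (*-zeroˡ (f [])))
move≡sum {suc N} b zero f (c ∷ v) = trans
  (move≡sum b zero (f ∘ (c ∷_)) v)
  -- A set containing the head has positive size, so its indicator of size zero is 0.
  (sumVec-cong N λ x → solve 3 (λ a b c → a := a :+ b :* (con 0ℚ :* c)) refl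
    (⟦ within b x v ⟧ * (⟦ does (card x ℕ.≟ 0) ⟧ * f (c ∷ toggle b x v)))
    ⟦ does (c ≟ b) ∧ within b x v ⟧ (f (not b ∷ toggle b x v)))
move≡sum {suc N} b (suc j) f (c ∷ v) = begin
  move b (suc j) (f ∘ (c ∷_)) v + e * move b j (f ∘ (not b ∷_)) v
    ≡⟨ cong₂ (λ p q → p + e * q) (move≡sum b (suc j) (f ∘ (c ∷_)) v) (move≡sum b j (f ∘ (not b ∷_)) v) ⟩
  sumVec N P + e * sumVec N Q
    ≡⟨ sumVec-linear N e P Q ⟨
  sumVec N (λ x → P x + e * Q x)
    ≡⟨ (sumVec-cong N λ x → cong (P x +_) (trans (sym (*-assoc e ⟦ within b x v ⟧ (⟦ does (card x ℕ.≟ j) ⟧ * f (not b ∷ toggle b x v))))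
         (cong (_* (⟦ does (card x ℕ.≟ j) ⟧ * f (not b ∷ toggle b x v))) (sym (⟦∧⟧ (does (c ≟ b)) (within b x v)))))) ⟩
  sumVec (suc N) (λ x → ⟦ within b x (c ∷ v) ⟧ * (⟦ does (card x ℕ.≟ suc j) ⟧ * f (toggle b x (c ∷ v)))) ∎
  where
  open ≡-Reasoning
  e = ⟦ does (c ≟ b) ⟧
  P Q : Vec Bool N → ℚ
  P x = ⟦ within b x v ⟧ * (⟦ does (card x ℕ.≟ suc j) ⟧ * f (c ∷ toggle b x v))
  Q x = ⟦ within b x v ⟧ * (⟦ does (card x ℕ.≟ j) ⟧ * f (not b ∷ toggle b x v))

sumList : (A → ℚ) → List A → ℚ
sumList f []       = 0ℚ
sumList f (x ∷ xs) = f x + sumList f xs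

sumList-cong : ∀ {f g : A → ℚ} → (∀ x → f x ≡ g x) → ∀ xs → sumList f xs ≡ sumList g xs
sumList-cong f≈g []       = refl
sumList-cong f≈g (x ∷ xs) = cong₂ _+_ (f≈g x) (sumList-cong f≈g xs)

sumList-++ : ∀ (f : A → ℚ) xs ys → sumList f (xs ++ ys) ≡ sumList f xs + sumList f ys
sumList-++ f []       ys = sym (+-identityˡ _)
sumList-++ f (x ∷ xs) ys = trans (cong (f x +_) (sumList-++ f xs ys)) (sym (+-assoc (f x) (sumList f xs) (sumList f ys)))

sumList-map : ∀ (f : B → ℚ) (g : A → B) xs → sumList f (map g xs) ≡ sumList (f ∘ g) xs
sumList-map f g []       = refl
sumList-map f g (x ∷ xs) = cong (f (g x) +_) (sumList-map f g xs)

sumList-concatMap : ∀ (f : B → ℚ) (g : A → List B) xs → sumList f (concatMap g xs) ≡ sumList (sumList f ∘ g) xs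
sumList-concatMap f g []       = refl
sumList-concatMap f g (x ∷ xs) = trans (sumList-++ f (g x) (concatMap g xs)) (cong (sumList f (g x) +_) (sumList-concatMap f g xs))

sumList-cartesianProduct : ∀ (f : A × B → ℚ) xs ys →
  sumList f (cartesianProduct xs ys) ≡ sumList (λ x → sumList (λ y → f (x , y)) ys) xs
sumList-cartesianProduct f []       ys = refl
sumList-cartesianProduct f (x ∷ xs) ys = trans
  (sumList-++ f (map (x ,_) ys) (cartesianProduct xs ys))
  (cong₂ _+_ (sumList-map f (x ,_) ys) (sumList-cartesianProduct f xs ys))

ι-count : ∀ (p : A → Bool) xs → ι (count p xs) ≡ sumList (λ x → ⟦ p x ⟧) xs
ι-count p []       = refl
ι-count p (x ∷ xs) with p x
... | true  = cong (1ℚ +_) (ι-count p xs)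
... | false = trans (ι-count p xs) (sym (+-identityˡ _))

-- Passing between graphs and vectors along a list of slots

Slots : ℕ → Set
Slots n = List (Fin n × Fin n)

infix 4 _≐_
_≐_ : Graph n → Graph n → Set
G ≐ H = ∀ a b → G a b ≡ H a b

read : (s : Slots n) → Graph n → Vec Bool (length s)
read []            G = []
read ((a , b) ∷ s) G = G a b ∷ read s G

draw : (s : Slots n) → Vec Bool (length s) → Graph n
draw []            []          = λ _ _ → false
draw ((a , b) ∷ s) (false ∷ v) = draw s v
draw ((a , b) ∷ s) (true ∷ v)  = addEdge (draw s v) a b

-- `graphsOn` lists every graph on the remaining slots without and then with the head edge. `sumVec`
-- sums the head innermost in the same order, so no rearrangement is involved.
sumList-graphsOn : ∀ (s : Slots n) (f : Graph n → ℚ) → sumList f (graphsOn s) ≡ sumVec (length s) (f ∘ draw s)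
sumList-graphsOn []            f = +-identityʳ (f (λ _ _ → false))
sumList-graphsOn ((a , b) ∷ s) f = trans
  (sumList-concatMap f (λ G → G ∷ addEdge G a b ∷ []) (graphsOn s))
  (trans (sumList-cong (λ G → cong (f G +_) (+-identityʳ (f (addEdge G a b)))) (graphsOn s))
         (sumList-graphsOn s (λ G → f G + f (addEdge G a b))))

Ordered : Slots n → Set
Ordered = All (λ e → proj₁ e Fin.< proj₂ e)

read-cong : ∀ {s : Slots n} {G H : Graph n} → All (λ e → G (proj₁ e) (proj₂ e) ≡ H (proj₁ e) (proj₂ e)) s → read s G ≡ read s H
read-cong []       = refl
read-cong (p ∷ ps) = cong₂ _∷_ p (read-cong ps)

joins : Fin n → Fin n → Fin n → Fin n → Bool
joins a b x y = ((x == a) ∧ (y == b)) ∨ ((x == b) ∧ (y == a))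

joins-here : ∀ (a b : Fin n) → joins a b a b ≡ true
joins-here a b rewrite dec-true (a Fin.≟ a) refl | dec-true (b Fin.≟ b) refl = refl

-- Since both pairs increase, a match in the reversed orientation would contradict asymmetry of the
-- order.
joins-other : ∀ {a b x y : Fin n} → a Fin.< b → x Fin.< y → (x , y) ≢ (a , b) → joins a b x y ≡ false
joins-other {a = a} {b} {x} {y} a<b x<y ne with x Fin.≟ a | y Fin.≟ b | x Fin.≟ b | y Fin.≟ a
... | yes refl | yes refl | _        | _        = contradiction refl ne
... | yes refl | no _     | yes refl | _        = contradiction a<b (Fin.<-irrefl refl)
... | no _     | _        | yes refl | yes refl = contradiction x<y (Fin.<-asym a<b)
... | yes refl | no _     | no _     | _        = refl
... | no _     | _        | no _     | _        = refl
... | no _     | _        | yes refl | no _     = refl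

joins-loop : ∀ {a b : Fin n} → a ≢ b → ∀ x → joins a b x x ≡ false
joins-loop {a = a} {b} a≢b x with x Fin.≟ a | x Fin.≟ b
... | yes refl | yes refl = contradiction refl a≢b
... | yes _    | no _     = refl
... | no _     | yes _    = refl
... | no _     | no _     = refl

joins-swap : ∀ (a b x y : Fin n) → joins a b x y ≡ joins b a x y
joins-swap a b x y = ∨-comm ((x == a) ∧ (y == b)) ((x == b) ∧ (y == a))

joins-flip : ∀ (a b x y : Fin n) → joins a b x y ≡ joins a b y x
joins-flip a b x y = trans (joins-swap a b x y) (cong₂ _∨_ (∧-comm (x == b) (y == a)) (∧-comm (x == a) (y == b)))

-- Unlike `addEdge`, this also deletes, so additions and removals can be treated together.
setEdge : Graph n → Fin n → Fin n → Bool → Graph n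
setEdge G a b c x y = if joins a b x y then c else G x y

addEdge≐setEdge : ∀ (G : Graph n) a b → addEdge G a b ≐ setEdge G a b true
addEdge≐setEdge G a b x y with (x == a) ∧ (y == b) | (x == b) ∧ (y == a)
... | true  | _     = refl
... | false | true  = refl
... | false | false = refl

open Simple

setEdge-simple : ∀ {G : Graph n} {a b} → Simple G → a ≢ b → ∀ c → Simple (setEdge G a b c)
setEdge-simple {G = G} {a} {b} sG a≢b c = record
  { symmetric   = λ x y → cong₂ (if_then c else_) (joins-flip a b x y) (symmetric sG x y)
  ; irreflexive = λ x → trans (cong (if_then c else G x x) (joins-loop a≢b x)) (irreflexive sG x)
  }

simple-resp : ∀ {G H : Graph n} → G ≐ H → Simple H → Simple G
simple-resp G≐H sH = record
  { symmetric   = λ x y → trans (G≐H x y) (trans (symmetric sH x y) (sym (G≐H y x)))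
  ; irreflexive = λ x → trans (G≐H x x) (irreflexive sH x)
  }

setEdge-here : ∀ (G : Graph n) a b c → setEdge G a b c a b ≡ c
setEdge-here G a b c = cong (if_then c else G a b) (joins-here a b)

setEdge-other : ∀ (G : Graph n) {a b x y} c → a Fin.< b → x Fin.< y → (x , y) ≢ (a , b) → setEdge G a b c x y ≡ G x y
setEdge-other G {x = x} {y} c a<b x<y ne = cong (if_then c else G x y) (joins-other a<b x<y ne)

addEdge-other : ∀ (G : Graph n) {a b x y} → a Fin.< b → x Fin.< y → (x , y) ≢ (a , b) → addEdge G a b x y ≡ G x y
addEdge-other G a<b x<y ne = trans (addEdge≐setEdge G _ _ _ _) (setEdge-other G true a<b x<y ne)

draw-∉ : ∀ {s : Slots n} (v : Vec Bool (length s)) → Ordered s → ∀ {a b} → a Fin.< b → (a , b) ∉ s → draw s v a b ≡ false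
draw-∉ {s = []}    []          _          a<b ∉s = refl
draw-∉ {s = _ ∷ s} (false ∷ v) (_ ∷ ord)  a<b ∉s = draw-∉ v ord a<b (∉s ∘ there)
draw-∉ {s = _ ∷ s} (true ∷ v)  (lt ∷ ord) a<b ∉s =
  trans (addEdge-other (draw s v) lt a<b (∉s ∘ here)) (draw-∉ v ord a<b (∉s ∘ there))

-- As slots are increasing and distinct, drawing one edge never affects the value read at another
-- slot.
read-draw : ∀ {s : Slots n} → Ordered s → Unique s → ∀ v → read s (draw s v) ≡ v
read-draw {s = []}          _         _          []          = refl
read-draw {s = (a , b) ∷ s} (lt ∷ ord) (∉s ∷ uniq) (false ∷ v) =
  cong₂ _∷_ (draw-∉ v ord lt (λ ∈s → All.lookup ∉s ∈s refl)) (read-draw ord uniq v)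
read-draw {s = (a , b) ∷ s} (lt ∷ ord) (∉s ∷ uniq) (true ∷ v) =
  cong₂ _∷_ (trans (addEdge≐setEdge (draw s v) a b a b) (setEdge-here (draw s v) a b true))
    (trans (read-cong (All.zipWith (λ { (x<y , ne) → addEdge-other (draw s v) lt x<y (ne ∘ sym) }) (ord , ∉s)))
           (read-draw ord uniq v))

draw-simple : ∀ {s : Slots n} → Ordered s → ∀ v → Simple (draw s v)
draw-simple {s = []}          ord        []          = record { symmetric = λ _ _ → refl ; irreflexive = λ _ → refl }
draw-simple {s = _ ∷ s}       (_ ∷ ord)  (false ∷ v) = draw-simple ord v
draw-simple {s = (a , b) ∷ s} (lt ∷ ord) (true ∷ v)  =
  simple-resp (addEdge≐setEdge (draw s v) a b) (setEdge-simple (draw-simple ord v) (Fin.<⇒≢ lt) true)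

-- The list of slots: completeness, order and uniqueness

slotsAt : Fin n → Fin n → Slots n
slotsAt a b = if a <ᵇ b then (a , b) ∷ [] else []

∈-slotsAt : ∀ {a b : Fin n} {e} → e ∈ slotsAt a b → e ≡ (a , b) × a Fin.< b
∈-slotsAt {a = a} {b} = go (a Fin.<? b)
  where
  -- Abstracting the decision lets the conditional reduce once `P?` is matched.
  go : ∀ {P : Set} (P? : Dec P) {e x : A} → e ∈ (if does P? then x ∷ [] else []) → e ≡ x × P
  go (yes p) (here refl) = refl , p

slotsAt-∈ : ∀ {a b : Fin n} → a Fin.< b → (a , b) ∈ slotsAt a b
slotsAt-∈ {a = a} {b} a<b rewrite dec-true (a Fin.<? b) a<b = here refl

∈-slots : ∀ {a b : Fin n} → a Fin.< b → (a , b) ∈ slots n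
∈-slots {n} {a} {b} a<b = ∈-concatMap⁺ (λ a → concatMap (slotsAt a) (allFin n))
  (Any.map (λ { refl → ∈-concatMap⁺ (slotsAt a) (Any.map (λ { refl → slotsAt-∈ a<b }) (∈-allFin b)) }) (∈-allFin a))

∈-row : ∀ {a : Fin n} {e} → e ∈ concatMap (slotsAt a) (allFin n) → proj₁ e ≡ a × proj₁ e Fin.< proj₂ e
∈-row {n} {a} e∈ with Any.satisfied (∈-concatMap⁻ (slotsAt a) {xs = allFin n} e∈)
... | b , e∈′ with ∈-slotsAt e∈′
... | refl , a<b = refl , a<b

slots-ordered : ∀ n → Ordered (slots n)
slots-ordered n = All.tabulate λ e∈ →
  proj₂ (∈-row (proj₂ (Any.satisfied (∈-concatMap⁻ (λ a → concatMap (slotsAt a) (allFin n)) {xs = allFin n} e∈))))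

Unique-concatMap : ∀ {f : A → List B} {xs} → (∀ x → Unique (f x)) →
  (∀ {x y z} → x ≢ y → z ∈ f x → z ∉ f y) → Unique xs → Unique (concatMap f xs)
Unique-concatMap {f = f} {xs} uf disj ux = Unique.concat⁺
  (All.map⁺ (All.tabulate (λ {x} _ → uf x)))
  (AllPairs.map⁺ (AllPairs.map (λ x≢y {_} p×q → disj x≢y (proj₁ p×q) (proj₂ p×q)) ux))

slots-unique : ∀ n → Unique (slots n)
slots-unique n = Unique-concatMap
  (λ a → Unique-concatMap (u a)
    (λ x≢y p q → x≢y (cong proj₂ (trans (sym (proj₁ (∈-slotsAt p))) (proj₁ (∈-slotsAt q)))))
    (Unique.allFin⁺ n))
  (λ x≢y p q → x≢y (trans (sym (proj₁ (∈-row p))) (proj₁ (∈-row q))))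
  (Unique.allFin⁺ n)
  where
  u : ∀ a b → Unique (slotsAt a b)
  u a b with a <ᵇ b
  ... | true  = [] ∷ []
  ... | false = []

read-injective : ∀ {s : Slots n} {G H : Graph n} → read s G ≡ read s H → ∀ {a b} → (a , b) ∈ s → G a b ≡ H a b
read-injective {s = _ ∷ s} eq (here refl) = cong Vec.head eq
read-injective {s = _ ∷ s} eq (there ∈s)  = read-injective {s = s} (cong Vec.tail eq) ∈s

-- Slots see only pairs `a < b`; symmetry supplies the transposed pairs and irreflexivity the
-- diagonal.
simple-≐ : ∀ {G H : Graph n} → Simple G → Simple H → read (slots n) G ≡ read (slots n) H → G ≐ H
simple-≐ sG sH eq a b with Fin.<-cmp a b
... | tri< a<b _ _ = read-injective eq (∈-slots a<b)
... | tri≈ _ refl _ = trans (irreflexive sG a) (sym (irreflexive sH a))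
... | tri> _ _ b<a = trans (symmetric sG a b) (trans (read-injective eq (∈-slots b<a)) (symmetric sH b a))

graph : Vec Bool (length (slots n)) → Graph n
graph {n} = draw (slots n)

vec : Graph n → Vec Bool (length (slots n))
vec {n} = read (slots n)

graph-simple : ∀ (v : Vec Bool (length (slots n))) → Simple (graph v)
graph-simple {n} = draw-simple (slots-ordered n)

vec-graph : ∀ (v : Vec Bool (length (slots n))) → vec (graph {n} v) ≡ v
vec-graph {n} = read-draw (slots-ordered n) (slots-unique n)

graph-vec : ∀ {G : Graph n} → Simple G → graph (vec G) ≐ G
graph-vec {G = G} sG = simple-≐ (graph-simple (vec G)) sG (vec-graph (vec G))

-- The deck conditions in terms of vectors

count≡card : ∀ (p : Fin n × Fin n → Bool) (G : Graph n) → (∀ a b → p (a , b) ≡ G a b) → ∀ s → count p s ≡ card (read s G)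
count≡card p G p≡ []            = refl
count≡card p G p≡ ((a , b) ∷ s) rewrite p≡ a b with G a b
... | true  = cong suc (count≡card p G p≡ s)
... | false = count≡card p G p≡ s

edges≡card : ∀ (G : Graph n) → edges G ≡ card (vec G)
edges≡card {n} G = count≡card _ G (λ _ _ → refl) (slots n)

all≡within : ∀ b (p : Fin n × Fin n → Bool) (X G : Graph n) → (∀ x y → p (x , y) ≡ not (X x y) ∨ does (G x y ≟ b)) →
  ∀ s → all p s ≡ within b (read s X) (read s G)
all≡within b p X G p≡ []            = refl
all≡within b p X G p≡ ((x , y) ∷ s) = cong₂ _∧_ (p≡ x y) (all≡within b p X G p≡ s)

⊆?≡within : ∀ (X G : Graph n) → (X ⊆? G) ≡ within true (vec X) (vec G)
⊆?≡within {n} X G = all≡within true _ X G (λ x y → cong (not (X x y) ∨_) (lem (G x y))) (slots n)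
  where
  lem : ∀ c → c ≡ does (c ≟ true)
  lem true  = refl
  lem false = refl

disjoint?≡within : ∀ (Y G : Graph n) → disjoint? Y G ≡ within false (vec Y) (vec G)
disjoint?≡within {n} Y G = all≡within false _ Y G (λ x y → lem (Y x y) (G x y)) (slots n)
  where
  lem : ∀ c d → not (c ∧ d) ≡ not c ∨ does (d ≟ false)
  lem true  true  = refl
  lem true  false = refl
  lem false true  = refl
  lem false false = refl

read-toggle : ∀ b (X G K : Graph n) → (∀ x y → K x y ≡ (if X x y then not b else G x y)) →
  ∀ s → read s K ≡ toggle b (read s X) (read s G)
read-toggle b X G K K≡ []            = refl
read-toggle b X G K K≡ ((x , y) ∷ s) = cong₂ _∷_ (K≡ x y) (read-toggle b X G K K≡ s)

_∖_ : Graph n → Graph n → Graph n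
(G ∖ X) a b = G a b ∧ not (X a b)

vec-∖ : ∀ (G X : Graph n) → vec (G ∖ X) ≡ toggle true (vec X) (vec G)
vec-∖ {n} G X = read-toggle true X G (G ∖ X) (λ x y → lem (G x y) (X x y)) (slots n)
  where
  lem : ∀ g x → g ∧ not x ≡ (if x then false else g)
  lem g true  = ∧-zeroʳ g
  lem g false = ∧-identityʳ g

vec-─⊕ : ∀ (G X Y : Graph n) → vec (G ─ X ⊕ Y) ≡ toggle false (vec Y) (toggle true (vec X) (vec G))
vec-─⊕ {n} G X Y = trans
  (read-toggle false Y (G ∖ X) (G ─ X ⊕ Y) (λ x y → lem ((G ∖ X) x y) (Y x y)) (slots n))
  (cong (toggle false (vec Y)) (vec-∖ G X))
  where
  lem : ∀ g x → g ∨ x ≡ (if x then true else g)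
  lem g true  = ∨-zeroʳ g
  lem g false = ∨-identityʳ g

─⊕-simple : ∀ {G X Y : Graph n} → Simple G → Simple X → Simple Y → Simple (G ─ X ⊕ Y)
─⊕-simple sG sX sY = record
  { symmetric   = λ a b → cong₂ _∨_ (cong₂ (λ g x → g ∧ not x) (symmetric sG a b) (symmetric sX a b)) (symmetric sY a b)
  ; irreflexive = λ a → cong₂ _∨_ (cong (_∧ _) (irreflexive sG a)) (irreflexive sY a)
  }


-- Isomorphism

infix 4 _≅_
record _≅_ (G H : Graph n) : Set where
  constructor iso
  field
    to        : Fin n → Fin n
    injective : ∀ {a b} → to a ≡ to b → a ≡ b
    preserves : ∀ a b → G a b ≡ H (to a) (to b)

≐⇒≅ : ∀ {G H : Graph n} → G ≐ H → G ≅ H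
≐⇒≅ G≐H = iso (λ a → a) (λ eq → eq) G≐H

≅-trans : ∀ {G H K : Graph n} → G ≅ H → H ≅ K → G ≅ K
≅-trans (iso σ σ-inj σ≡) (iso τ τ-inj τ≡) = iso (τ ∘ σ) (σ-inj ∘ τ-inj) λ a b → trans (σ≡ a b) (τ≡ (σ a) (σ b))

-- Pigeonhole: if `y` were missed, punching it out would inject `Fin (suc n)` into `Fin n`. Thus the
-- injections tested by `_≅?_` are permutations and isomorphism is symmetric.
injective⇒preimage : ∀ {σ : Fin n → Fin n} → (∀ {a b} → σ a ≡ σ b → a ≡ b) → ∀ y → ∃ λ x → σ x ≡ y
injective⇒preimage {n} {σ} σ-inj y with Fin.any? (λ x → σ x Fin.≟ y)
... | yes found = found
injective⇒preimage {suc n} {σ} σ-inj y | no ¬found = contradiction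
  (Fin.injective⇒≤ {f = λ x → Fin.punchOut (y≢ x)} (λ {a} {b} eq → σ-inj (Fin.punchOut-injective (y≢ a) (y≢ b) eq)))
  ℕ.1+n≰n
  where
  y≢ : ∀ x → y ≢ σ x
  y≢ x y≡ = ¬found (x , sym y≡)

injective⇒permutation : ∀ {σ : Fin n → Fin n} → (∀ {a b} → σ a ≡ σ b → a ≡ b) → Permutation n n
injective⇒permutation {σ = σ} σ-inj = permutation σ (proj₁ ∘ injective⇒preimage σ-inj)
  (proj₂ ∘ injective⇒preimage σ-inj) (λ x → σ-inj (proj₂ (injective⇒preimage σ-inj (σ x))))

≅-sym : ∀ {G H : Graph n} → G ≅ H → H ≅ G
≅-sym {H = H} (iso σ σ-inj σ≡) = iso τ
  (λ {a} {b} eq → trans (sym (στ a)) (trans (cong σ eq) (στ b)))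
  (λ a b → trans (sym (cong₂ H (στ a) (στ b))) (sym (σ≡ (τ a) (τ b))))
  where
  τ = proj₁ ∘ injective⇒preimage σ-inj
  στ : ∀ a → σ (τ a) ≡ a
  στ = proj₂ ∘ injective⇒preimage σ-inj

all-allFin⁻ : ∀ (p : Fin n → Bool) → T (all p (allFin n)) → ∀ a → T (p a)
all-allFin⁻ {n} p t a = All.lookup (All.all⁺ p (allFin n) t) (∈-allFin a)

all-allFin⁺ : ∀ (p : Fin n → Bool) → (∀ a → T (p a)) → T (all p (allFin n))
all-allFin⁺ {n} p t = All.all⁻ p (All.tabulate {xs = allFin n} (λ {a} _ → t a))

injective?⁻ : ∀ (σ : Fin n → Fin n) → T (injective? σ) → ∀ {a b} → σ a ≡ σ b → a ≡ b
injective?⁻ σ t {a} {b} σa≡σb with σ a Fin.≟ σ b | a Fin.≟ b | all-allFin⁻ _ (all-allFin⁻ _ t a) b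
... | _     | yes a≡b | _ = a≡b
... | no ne | no _    | _ = contradiction σa≡σb ne

injective?⁺ : ∀ (σ : Fin n → Fin n) → (∀ {a b} → σ a ≡ σ b → a ≡ b) → T (injective? σ)
injective?⁺ σ σ-inj = all-allFin⁺ _ λ a → all-allFin⁺ _ λ b → go a b
  where
  go : ∀ a b → T (not (σ a == σ b) ∨ (a == b))
  go a b with σ a Fin.≟ σ b | a Fin.≟ b
  ... | no _  | _      = tt
  ... | yes _ | yes _  = tt
  ... | yes e | no a≢b = a≢b (σ-inj e)

≟⁻ : ∀ x y → T (does (x ≟ y)) → x ≡ y
≟⁻ true  true  _ = refl
≟⁻ false false _ = refl

-- Occurrence up to pointwise equality is enough, because the isomorphism test looks only at values.
∈-maps : ∀ k n (σ : Fin k → Fin n) → Any (λ f → ∀ x → f x ≡ σ x) (maps k n)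
∈-maps zero    n σ = here λ ()
∈-maps (suc k) n σ = Any.concatMap⁺ _ (Any.map (λ { refl → Any.map⁺ (Any.map (λ { f≡σ zero → refl ; f≡σ (suc x) → f≡σ x }) (∈-maps k n (σ ∘ suc))) }) (∈-allFin (σ zero)))

≅?⇒≅ : ∀ (G H : Graph n) → (G ≅? H) ≡ true → G ≅ H
≅?⇒≅ {n} G H eq with Any.satisfied (Any.any⁻ _ (maps n n) (Equivalence.from T-≡ eq))
... | σ , t with Equivalence.to T-∧ t
...   | t₁ , t₂ = iso σ (injective?⁻ σ t₁) λ a b → ≟⁻ _ _ (all-allFin⁻ _ (all-allFin⁻ _ t₂ a) b)

≅⇒≅? : ∀ {G H : Graph n} → G ≅ H → (G ≅? H) ≡ true
≅⇒≅? {n} {G} {H} (iso σ σ-inj σ≡) = Equivalence.to T-≡ (Any.any⁺ _ (Any.map good (∈-maps n n σ)))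
  where
  good : ∀ {f} → (∀ x → f x ≡ σ x) → T (injective? f ∧ all (λ a → all (λ b → does (G a b ≟ H (f a) (f b))) (allFin n)) (allFin n))
  good {f} f≡σ = Equivalence.from T-∧
    ( injective?⁺ f (λ {a} {b} eq → σ-inj (trans (sym (f≡σ a)) (trans eq (f≡σ b))))
    , all-allFin⁺ _ λ a → all-allFin⁺ _ λ b →
        Equivalence.from T-≡ (dec-true (G a b ≟ H (f a) (f b)) (trans (σ≡ a b) (sym (cong₂ H (f≡σ a) (f≡σ b))))) )

≅?-resp : ∀ {G K : Graph n} → G ≅ K → ∀ H → (G ≅? H) ≡ (K ≅? H)
≅?-resp {G = G} {K} G≅K H with G ≅? H in eq₁ | K ≅? H in eq₂
... | true  | true  = refl
... | false | false = refl
... | true  | false = trans (sym (≅⇒≅? (≅-trans (≅-sym G≅K) (≅?⇒≅ G H eq₁)))) eq₂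
... | false | true  = trans (sym eq₁) (≅⇒≅? (≅-trans G≅K (≅?⇒≅ K H eq₂)))

-- The membership test is a conjunction, so its indicator is a product. Factors in `X` alone leave
-- the inner sum, which becomes the additions; the outer sum becomes the removals.
deckSum : ∀ j {G : Graph n} (H : Graph n) → Simple G →
  ι (deckCount j G H) ≡ swap j (λ w → ⟦ graph w ≅? H ⟧) (vec G)
deckSum {n} j {G} H sG = begin
  ι (deckCount j G H)
    ≡⟨ ι-count _ (cartesianProduct (graphs n) (graphs n)) ⟩
  sumList _ (cartesianProduct (graphs n) (graphs n))
    ≡⟨ sumList-cartesianProduct _ (graphs n) (graphs n) ⟩
  sumList (λ X → sumList (λ Y → ⟦ member X Y ⟧) (graphs n)) (graphs n)
    ≡⟨ sumList-graphsOn (slots n) _ ⟩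
  sumVec M (λ x → sumList (λ Y → ⟦ member (graph x) Y ⟧) (graphs n))
    ≡⟨ (sumVec-cong M λ x → trans (sumList-graphsOn (slots n) _) (inner x)) ⟩
  sumVec M (λ x → ⟦ within true x g ⟧ * (⟦ does (card x ℕ.≟ j) ⟧ * move false j P (toggle true x g)))
    ≡⟨ move≡sum true j (move false j P) g ⟨
  swap j P g ∎
  where
  open ≡-Reasoning
  M = length (slots n)
  g = vec G
  P : Vec Bool M → ℚ
  P w = ⟦ graph w ≅? H ⟧
  member : Graph n → Graph n → Bool
  member X Y = (X ⊆? G) ∧ does (edges X ℕ.≟ j) ∧ disjoint? Y (G ∖ X) ∧ does (edges Y ℕ.≟ j) ∧ ((G ─ X ⊕ Y) ≅? H)
  term : ∀ x y → ⟦ member (graph x) (graph y) ⟧ ≡ ⟦ within true x g ⟧ * (⟦ does (card x ℕ.≟ j) ⟧ *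
    (⟦ within false y (toggle true x g) ⟧ * (⟦ does (card y ℕ.≟ j) ⟧ * P (toggle false y (toggle true x g)))))
  term x y = begin
    ⟦ member X Y ⟧
      ≡⟨ cong ⟦_⟧ (cong₂ _∧_ (trans (⊆?≡within X G) (cong (λ z → within true z g) x≡))
          (cong₂ _∧_ (cong (λ z → does (z ℕ.≟ j)) (trans (edges≡card X) (cong card x≡)))
          (cong₂ _∧_ (trans (disjoint?≡within Y (G ∖ X)) (cong₂ (within false) y≡ (trans (vec-∖ G X) (cong (λ z → toggle true z g) x≡))))
          (cong₂ _∧_ (cong (λ z → does (z ℕ.≟ j)) (trans (edges≡card Y) (cong card y≡)))
            -- G - X + Y and the graph drawn from `w` agree only pointwise, so the test is
            -- transported along an isomorphism.
            (≅?-resp (≐⇒≅ (simple-≐ (─⊕-simple sG (graph-simple x) (graph-simple y)) (graph-simple w)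
              (trans (vec-─⊕ G X Y) (trans (cong₂ (λ p q → toggle false p (toggle true q g)) y≡ x≡) (sym (vec-graph w)))))) H))))) ⟩
    ⟦ b₁ ∧ b₂ ∧ b₃ ∧ b₄ ∧ b₅ ⟧
      ≡⟨ trans (⟦∧⟧ b₁ _) (cong (⟦ b₁ ⟧ *_) (trans (⟦∧⟧ b₂ _) (cong (⟦ b₂ ⟧ *_) (trans (⟦∧⟧ b₃ _) (cong (⟦ b₃ ⟧ *_) (⟦∧⟧ b₄ b₅)))))) ⟩
    ⟦ b₁ ⟧ * (⟦ b₂ ⟧ * (⟦ b₃ ⟧ * (⟦ b₄ ⟧ * ⟦ b₅ ⟧))) ∎
    where
    X = graph x
    Y = graph y
    w = toggle false y (toggle true x g)
    x≡ = vec-graph {n} x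
    y≡ = vec-graph {n} y
    b₁ = within true x g
    b₂ = does (card x ℕ.≟ j)
    b₃ = within false y (toggle true x g)
    b₄ = does (card y ℕ.≟ j)
    b₅ = graph w ≅? H
  inner : ∀ x → sumVec M (λ y → ⟦ member (graph x) (graph y) ⟧) ≡
    ⟦ within true x g ⟧ * (⟦ does (card x ℕ.≟ j) ⟧ * move false j P (toggle true x g))
  inner x = trans (sumVec-cong M (term x))
    (trans (sumVec-scale M ⟦ within true x g ⟧ _) (cong (⟦ within true x g ⟧ *_)
    (trans (sumVec-scale M ⟦ does (card x ℕ.≟ j) ⟧ _) (cong (⟦ does (card x ℕ.≟ j) ⟧ *_)
      (sym (move≡sum false j P (toggle true x g)))))))

-- Isomorphism invariance of single moves

move₁≡sum : ∀ b (h : Vec Bool N → ℚ) v → move b 1 h v ≡ sum (λ i → ⟦ does (lookup v i ≟ b) ⟧ * h (v [ i ]≔ not b))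
move₁≡sum b h []      = refl
move₁≡sum b h (c ∷ v) = trans
  (+-comm (move b 1 (h ∘ (c ∷_)) v) (⟦ does (c ≟ b) ⟧ * h (not b ∷ v)))
  (cong (⟦ does (c ≟ b) ⟧ * h (not b ∷ v) +_) (move₁≡sum b (h ∘ (c ∷_)) v))

lookup-read : ∀ (s : Slots n) (G : Graph n) i → lookup (read s G) i ≡ G (proj₁ (List.lookup s i)) (proj₂ (List.lookup s i))
lookup-read (_ ∷ s) G zero    = refl
lookup-read (_ ∷ s) G (suc i) = lookup-read s G i

read-setEdge : ∀ {s : Slots n} → Ordered s → Unique s → ∀ (G : Graph n) i c →
  read s G [ i ]≔ c ≡ read s (setEdge G (proj₁ (List.lookup s i)) (proj₂ (List.lookup s i)) c)
read-setEdge {s = (a , b) ∷ s} (lt ∷ ord) (∉s ∷ uniq) G zero c = sym (cong₂ _∷_ (setEdge-here G a b c)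
  (read-cong (All.zipWith (λ { (x<y , ne) → setEdge-other G c lt x<y (ne ∘ sym) }) (ord , ∉s))))
read-setEdge {s = (a , b) ∷ s} (lt ∷ ord) (∉s ∷ uniq) G (suc i) c = cong₂ _∷_
  (sym (setEdge-other G c (All.lookup ord (∈-lookup {xs = s} i)) lt (All.lookup ∉s (∈-lookup {xs = s} i))))
  (read-setEdge ord uniq G i c)

sum-lookup : ∀ {A : Set} (f : A → ℚ) xs → sum (λ i → f (List.lookup xs i)) ≡ sumList f xs
sum-lookup f []       = refl
sum-lookup f (x ∷ xs) = cong (f x +_) (sum-lookup f xs)

sumList-tabulate : ∀ {A : Set} {n} (f : A → ℚ) (g : Fin n → A) → sumList f (List.tabulate g) ≡ sum (f ∘ g)
sumList-tabulate {n = zero}  f g = refl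
sumList-tabulate {n = suc n} f g = cong (f (g zero) +_) (sumList-tabulate f (g ∘ suc))

upper : (Fin n → Fin n → ℚ) → Fin n → Fin n → ℚ
upper F a b = if a <ᵇ b then F a b else 0ℚ

-- The diagonal is cut out because setting a loop can leave the simple graphs, where `Invariant`
-- says nothing.
offDiagonal : (Fin n → Fin n → ℚ) → Fin n → Fin n → ℚ
offDiagonal F a b = if a == b then 0ℚ else F a b

sumList-slots : ∀ (F : Fin n → Fin n → ℚ) → sumList (λ e → F (proj₁ e) (proj₂ e)) (slots n) ≡ sum (λ a → sum (upper F a))
sumList-slots {n} F = begin
  sumList F′ (slots n)
    ≡⟨ sumList-concatMap F′ (λ a → concatMap (slotsAt a) (allFin n)) (allFin n) ⟩
  sumList (λ a → sumList F′ (concatMap (slotsAt a) (allFin n))) (allFin n)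
    ≡⟨ sumList-tabulate (λ a → sumList F′ (concatMap (slotsAt a) (allFin n))) (λ a → a) ⟩
  sum (λ a → sumList F′ (concatMap (slotsAt a) (allFin n)))
    ≡⟨ sum-cong-≗ (λ a → trans (sumList-concatMap F′ (slotsAt a) (allFin n))
         (trans (sumList-tabulate (sumList F′ ∘ slotsAt a) (λ b → b)) (sum-cong-≗ (λ b → cell a b)))) ⟩
  sum (λ a → sum (upper F a)) ∎
  where
  open ≡-Reasoning
  F′ : Fin n × Fin n → ℚ
  F′ e = F (proj₁ e) (proj₂ e)
  cell : ∀ a b → sumList F′ (slotsAt a b) ≡ upper F a b
  cell a b with a <ᵇ b
  ... | true  = +-identityʳ (F a b)
  ... | false = refl

upper+lower : ∀ (F : Fin n → Fin n → ℚ) → (∀ a b → a ≢ b → F a b ≡ F b a) →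
  ∀ a b → upper F a b + upper F b a ≡ offDiagonal F a b
upper+lower F F-sym a b with Fin.<-cmp a b
... | tri< a<b a≢b a≯b rewrite dec-true (a Fin.<? b) a<b | dec-false (b Fin.<? a) a≯b | dec-false (a Fin.≟ b) a≢b = +-identityʳ (F a b)
... | tri≈ a≮b a≡b a≯b rewrite dec-false (a Fin.<? b) a≮b | dec-false (b Fin.<? a) a≯b | dec-true (a Fin.≟ b) a≡b = refl
... | tri> a≮b a≢b a>b rewrite dec-false (a Fin.<? b) a≮b | dec-true (b Fin.<? a) a>b | dec-false (a Fin.≟ b) a≢b =
  trans (+-identityˡ (F b a)) (sym (F-sym a b a≢b))

-- Exchanging the summations in one copy transposes it into the lower triangle.
sum-upper : ∀ (F : Fin n → Fin n → ℚ) → (∀ a b → a ≢ b → F a b ≡ F b a) →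
  sum (λ a → sum (upper F a)) + sum (λ a → sum (upper F a)) ≡ sum (λ a → sum (offDiagonal F a))
sum-upper F F-sym = begin
  sum (λ a → sum (upper F a)) + sum (λ a → sum (upper F a))
    ≡⟨ cong (sum (λ a → sum (upper F a)) +_) (∑-comm (upper F)) ⟩
  sum (λ a → sum (upper F a)) + sum (λ a → sum (λ b → upper F b a))
    ≡⟨ ∑-distrib-+ (λ a → sum (upper F a)) (λ a → sum (λ b → upper F b a)) ⟨
  sum (λ a → sum (upper F a) + sum (λ b → upper F b a))
    ≡⟨ sum-cong-≗ (λ a → trans (sym (∑-distrib-+ (upper F a) (λ b → upper F b a))) (sum-cong-≗ (upper+lower F F-sym a))) ⟩
  sum (λ a → sum (offDiagonal F a)) ∎
  where open ≡-Reasoning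

==-injective : ∀ {σ : Fin n → Fin n} → (∀ {a b} → σ a ≡ σ b → a ≡ b) → ∀ a b → (σ a == σ b) ≡ (a == b)
==-injective {σ = σ} σ-inj a b with a Fin.≟ b
... | yes a≡b = dec-true (σ a Fin.≟ σ b) (cong σ a≡b)
... | no a≢b  = dec-false (σ a Fin.≟ σ b) (a≢b ∘ σ-inj)

setEdge-≅ : ∀ {K L : Graph n} (K≅L : K ≅ L) a b c → setEdge K a b c ≅ setEdge L (_≅_.to K≅L a) (_≅_.to K≅L b) c
setEdge-≅ (iso σ σ-inj σ≡) a b c = iso σ σ-inj λ x y → cong₂ (if_then c else_)
  (sym (cong₂ _∨_ (cong₂ _∧_ (==-injective σ-inj x a) (==-injective σ-inj y b))
                  (cong₂ _∧_ (==-injective σ-inj x b) (==-injective σ-inj y a))))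
  (σ≡ x y)

Invariant : (Graph n → ℚ) → Set
Invariant f = ∀ {K L} → Simple K → Simple L → K ≅ L → f K ≡ f L

flipTerm : Bool → (Graph n → ℚ) → Graph n → Fin n → Fin n → ℚ
flipTerm b f K x y = ⟦ does (K x y ≟ b) ⟧ * f (setEdge K x y (not b))

flipTerm-sym : ∀ b {f : Graph n → ℚ} → Invariant f → ∀ {K} → Simple K → ∀ x y → x ≢ y → flipTerm b f K x y ≡ flipTerm b f K y x
flipTerm-sym b f-inv {K} sK x y x≢y = cong₂ (λ c → ⟦ does (c ≟ b) ⟧ *_) (Simple.symmetric sK x y)
  (f-inv (setEdge-simple sK x≢y (not b)) (setEdge-simple sK (x≢y ∘ sym) (not b))
    (≐⇒≅ λ u v → cong (if_then not b else K u v) (joins-swap x y u v)))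

-- Doubling turns the sum over slots a < b into one over ordered pairs, which a relabelling permutes.
double-move₁ : ∀ b {f : Graph n → ℚ} → Invariant f → ∀ {K} → Simple K →
  move b 1 (f ∘ graph) (vec K) + move b 1 (f ∘ graph) (vec K) ≡ sum (λ x → sum (offDiagonal (flipTerm b f K) x))
double-move₁ {n} b {f} f-inv {K} sK = trans (cong (λ z → z + z) slotwise) (sum-upper F (flipTerm-sym b f-inv sK))
  where
  open ≡-Reasoning
  F = flipTerm b f K
  term : ∀ i → let e = List.lookup (slots n) i in
    ⟦ does (lookup (vec K) i ≟ b) ⟧ * f (graph (vec K [ i ]≔ not b)) ≡ F (proj₁ e) (proj₂ e)
  term i = cong₂ (λ c → ⟦ does (c ≟ b) ⟧ *_) (lookup-read (slots n) K i)
    (trans (cong (f ∘ graph) (read-setEdge (slots-ordered n) (slots-unique n) K i (not b)))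
           (f-inv (graph-simple _) s′ (≐⇒≅ (graph-vec s′))))
    where
    s′ = setEdge-simple sK (Fin.<⇒≢ (All.lookup (slots-ordered n) (∈-lookup {xs = slots n} i))) (not b)
  slotwise : move b 1 (f ∘ graph) (vec K) ≡ sum (λ x → sum (upper F x))
  slotwise = begin
    move b 1 (f ∘ graph) (vec K)
      ≡⟨ move₁≡sum b (f ∘ graph) (vec K) ⟩
    sum (λ i → ⟦ does (lookup (vec K) i ≟ b) ⟧ * f (graph (vec K [ i ]≔ not b)))
      ≡⟨ sum-cong-≗ term ⟩
    sum (λ i → F (proj₁ (List.lookup (slots n) i)) (proj₂ (List.lookup (slots n) i)))
      ≡⟨ sum-lookup (λ e → F (proj₁ e) (proj₂ e)) (slots n) ⟩
    sumList (λ e → F (proj₁ e) (proj₂ e)) (slots n)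
      ≡⟨ sumList-slots F ⟩
    sum (λ x → sum (upper F x)) ∎

-- An isomorphism `σ` matches the term of `K` at `(x , y)` with that of `L` at `(σ x , σ y)`; as `σ`
-- is a permutation, both sums may be reindexed.
sum-offDiagonal-invariant : ∀ b {f : Graph n → ℚ} → Invariant f →
  Invariant (λ K → sum (λ x → sum (offDiagonal (flipTerm b f K) x)))
sum-offDiagonal-invariant b {f} f-inv {K} {L} sK sL K≅L@(iso σ σ-inj σ≡) = begin
  sum (λ x → sum (offDiagonal (flipTerm b f K) x))
    ≡⟨ sum-cong-≗ (λ x → sum-cong-≗ (cell x)) ⟩
  sum (λ x → sum (λ y → offDiagonal (flipTerm b f L) (σ x) (σ y)))
    ≡⟨ sum-cong-≗ (λ x → sum-permute (offDiagonal (flipTerm b f L) (σ x)) π) ⟨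
  sum (λ x → sum (offDiagonal (flipTerm b f L) (σ x)))
    ≡⟨ sum-permute (λ x → sum (offDiagonal (flipTerm b f L) x)) π ⟨
  sum (λ x → sum (offDiagonal (flipTerm b f L) x)) ∎
  where
  open ≡-Reasoning
  π = injective⇒permutation σ-inj
  cell : ∀ x y → offDiagonal (flipTerm b f K) x y ≡ offDiagonal (flipTerm b f L) (σ x) (σ y)
  cell x y rewrite ==-injective σ-inj x y with x Fin.≟ y
  ... | yes _  = refl
  ... | no x≢y = cong₂ (λ c → ⟦ does (c ≟ b) ⟧ *_) (σ≡ x y)
    (f-inv (setEdge-simple sK x≢y (not b)) (setEdge-simple sL (x≢y ∘ σ-inj) (not b)) (setEdge-≅ K≅L x y (not b)))

halve : ∀ {p q : ℚ} → p + p ≡ q + q → p ≡ q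
halve {p} {q} eq = trans (sym (half p)) (trans (cong (½ *_) eq) (half q))
  where
  half : ∀ r → ½ * (r + r) ≡ r
  half r = trans (*-distribˡ-+ ½ r r) (trans (sym (*-distribʳ-+ r ½ ½)) (*-identityˡ r))

move₁-invariant : ∀ b {f : Graph n → ℚ} → Invariant f → Invariant (λ K → move b 1 (f ∘ graph) (vec K))
move₁-invariant b f-inv sK sL K≅L = halve (trans (double-move₁ b f-inv sK)
  (trans (sum-offDiagonal-invariant b f-inv sK sL K≅L) (sym (double-move₁ b f-inv sL))))

-- Single-move invariance is applied twice, first to the addition and then to the removal; `reread`
-- presents the inner sum as a function of graphs so that the second application fits.
swap₁-invariant : ∀ {f : Graph n → ℚ} → Invariant f → Invariant (λ K → swap 1 (f ∘ graph) (vec K))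
swap₁-invariant {n} {f} f-inv {K} {L} sK sL K≅L = trans (reread K)
  (trans (move₁-invariant true added-inv sK sL K≅L) (sym (reread L)))
  where
  added : Graph n → ℚ
  added K = move false 1 (f ∘ graph) (vec K)
  added-inv : Invariant added
  added-inv = move₁-invariant false f-inv
  reread : ∀ K → swap 1 (f ∘ graph) (vec K) ≡ move true 1 (added ∘ graph) (vec K)
  reread K = move-cong-≗ true 1 (vec K) λ w → cong (move false 1 (f ∘ graph)) (sym (vec-graph {n} w))

-- The matrices Δ

private variable
  k : ℕ

-- As many edges are added as removed, so only vectors of the size of `v` are evaluated.
swap-cong : ∀ j {f g : Vec Bool N → ℚ} v → (∀ w → card w ≡ card v → f w ≡ g w) → swap j f v ≡ swap j g v
swap-cong j v f≈g = move-cong true j v λ u p _ → move-cong false j u λ w _ q → f≈g w (trans q p)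

swap-linear : ∀ j p (f g : Vec Bool N → ℚ) v → swap j (λ w → p * f w + g w) v ≡ p * swap j f v + swap j g v
swap-linear j p f g v = trans
  (move-cong-≗ true j v (move-linear false j p f g))
  (move-linear true j p (move false j f) (move false j g) v)

swap-0 : ∀ j (v : Vec Bool N) → swap j (λ _ → 0ℚ) v ≡ 0ℚ
swap-0 j v = trans (move-cong-≗ true j v (move-0 false j)) (move-0 true j v)

swap-sum : ∀ j (a : Fin k → ℚ) (f : Fin k → Vec Bool N → ℚ) v →
  swap j (λ w → sum (λ z → a z * f z w)) v ≡ sum (λ z → a z * swap j (f z) v)
swap-sum {zero}  j a f v = swap-0 j v
swap-sum {suc k} j a f v = trans
  (swap-linear j (a zero) (f zero) (λ w → sum (λ z → a (suc z) * f (suc z) w)) v)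
  (cong (a zero * swap j (f zero) v +_) (swap-sum j (a ∘ suc) (f ∘ suc) v))

sum-single : ∀ (a : Fin k → ℚ) (q : Fin k → Bool) z₀ → q z₀ ≡ true → (∀ z → q z ≡ true → z ≡ z₀) →
  sum (λ z → a z * ⟦ q z ⟧) ≡ a z₀
sum-single {suc k} a q zero q₀ uniq = trans
  (cong₂ _+_ (trans (cong (λ c → a zero * ⟦ c ⟧) q₀) (*-identityʳ (a zero)))
    (trans (sum-cong-≗ λ z → trans (cong (λ c → a (suc z) * ⟦ c ⟧) (off z)) (*-zeroʳ (a (suc z)))) (sum-replicate-zero k)))
  (+-identityʳ (a zero))
  where
  off : ∀ z → q (suc z) ≡ false
  off z with q (suc z) in eq
  ... | false = refl
  ... | true  with () ← uniq (suc z) eq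
sum-single {suc k} a q (suc z₀) q₀ uniq = trans
  (cong₂ _+_ (trans (cong (λ c → a zero * ⟦ c ⟧) off) (*-zeroʳ (a zero)))
    (sum-single (a ∘ suc) (q ∘ suc) z₀ q₀ (λ z qz → Fin.suc-injective (uniq (suc z) qz))))
  (+-identityˡ (a (suc z₀)))
  where
  off : q zero ≡ false
  off with q zero in eq
  ... | false = refl
  ... | true  with () ← uniq zero eq

sumℚ≡sum : ∀ (f : Fin k → ℚ) → sumℚ f ≡ sum f
sumℚ≡sum {zero}  f = refl
sumℚ≡sum {suc k} f = cong (f zero +_) (sumℚ≡sum (f ∘ suc))

count-false+card : ∀ (v : Vec Bool N) → Vec.count (_≟ false) v ℕ.+ card v ≡ N
count-false+card []          = refl
count-false+card (false ∷ v) = cong suc (count-false+card v)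
count-false+card (true ∷ v)  = trans (ℕ.+-suc _ _) (cong suc (count-false+card v))

excess≡ : ∀ (v : Vec Bool N) → excess v ≡ ι (N ℕ.∸ card v) - ι (card v)
excess≡ {N} v = cong (λ z → ι z - ι (card v))
  (trans (sym (ℕ.m+n∸n≡m _ (card v))) (cong (ℕ._∸ card v) (count-false+card v)))

ι-nonNegative : ∀ n → 0ℚ ℚ.≤ ι n
ι-nonNegative zero    = ≤-refl
ι-nonNegative (suc n) = +-mono-≤ (nonNegative⁻¹ 1ℚ) (ι-nonNegative n)

ι-suc≢0 : ∀ n → ι (suc n) ≢ 0ℚ
ι-suc≢0 n eq = <-irrefl (sym eq) (+-mono-<-≤ (positive⁻¹ 1ℚ) (ι-nonNegative n))

module _ {n m k : ℕ} {reps : Fin k → Graph n} (enum : IsoClassEnum n m reps) where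

  open IsoClassEnum enum

  isoTo : Fin k → Graph n → ℚ
  isoTo x K = ⟦ K ≅? reps x ⟧

  isoTo-invariant : ∀ x → Invariant (isoTo x)
  isoTo-invariant x _ _ K≅L = cong ⟦_⟧ (≅?-resp K≅L (reps x))

  Δ≡swap : ∀ j x y → Δ reps j x y ≡ swap j (isoTo x ∘ graph) (vec (reps y))
  Δ≡swap j x y = trans (sym (ι≡ℕ→ℚ (deckCount j (reps y) (reps x))))
    (deckSum j (reps x) (simple y))

  card-reps : ∀ y → card (vec (reps y)) ≡ m
  card-reps y = trans (sym (edges≡card (reps y))) (size y)

  -- Exactly one summand survives: `complete` gives a representative isomorphic to the graph and
  -- `distinct` makes it unique. This expands an invariant in class indicators.
  classify : ∀ (f : Graph n → ℚ) → Invariant f → ∀ w → card w ≡ m →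
    sum (λ z → f (reps z) * isoTo z (graph w)) ≡ f (graph w)
  classify f f-inv w w≡m with complete (graph w) (graph-simple {n} w)
    (trans (edges≡card (graph {n} w)) (trans (cong card (vec-graph {n} w)) w≡m))
  ... | z₀ , eq = trans
    (sum-single (f ∘ reps) (λ z → graph w ≅? reps z) z₀ eq
      λ z eq′ → distinct z z₀ (≅⇒≅? (≅-trans (≅-sym (≅?⇒≅ (graph w) (reps z) eq′)) w≅z₀)))
    (sym (f-inv (graph-simple {n} w) (simple z₀) w≅z₀))
    where
    w≅z₀ = ≅?⇒≅ (graph w) (reps z₀) eq

  -- By linearity the sum over `z` moves inside the j-move, where `classify` replaces the
  -- representative by the labelled graph actually reached.
  Δ₁⊗Δ≡swap : ∀ j x y → (Δ reps 1 ⊗ Δ reps j) x y ≡ swap j (swap 1 (isoTo x ∘ graph)) (vec (reps y))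
  Δ₁⊗Δ≡swap j x y = begin
    sumℚ (λ z → Δ reps 1 x z * Δ reps j z y)
      ≡⟨ sumℚ≡sum (λ z → Δ reps 1 x z * Δ reps j z y) ⟩
    sum (λ z → Δ reps 1 x z * Δ reps j z y)
      ≡⟨ sum-cong-≗ (λ z → cong₂ _*_ (Δ≡swap 1 x z) (Δ≡swap j z y)) ⟩
    sum (λ z → f (reps z) * swap j (isoTo z ∘ graph) (vec (reps y)))
      ≡⟨ swap-sum j (f ∘ reps) (λ z → isoTo z ∘ graph) (vec (reps y)) ⟨
    swap j (λ w → sum (λ z → f (reps z) * isoTo z (graph w))) (vec (reps y))
      ≡⟨ swap-cong j (vec (reps y)) (λ w eq → trans
           (classify f (swap₁-invariant (isoTo-invariant x)) w (trans eq (card-reps y)))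
           (cong (swap 1 (isoTo x ∘ graph)) (vec-graph {n} w))) ⟩
    swap j (swap 1 (isoTo x ∘ graph)) (vec (reps y)) ∎
    where
    open ≡-Reasoning
    f : Graph n → ℚ
    f K = swap 1 (isoTo x ∘ graph) (vec K)

  -- The coefficient j (N - 2m + j + 1) of the recurrence at index `suc j`, with N - m and m as the
  -- numbers of non-edges and edges.
  slope : ℕ → ℚ
  slope j = ι (suc j) * ((ι (length (slots n) ℕ.∸ m) - ι m) + ι (suc (suc j)))

  Δ₁⊗Δ : ∀ j x y → (Δ reps 1 ⊗ Δ reps (suc j)) x y ≡
    ι (suc (suc j)) * ι (suc (suc j)) * Δ reps (suc (suc j)) x y + slope j * Δ reps (suc j) x y
  Δ₁⊗Δ j x y = begin
    (Δ reps 1 ⊗ Δ reps (suc j)) x y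
      ≡⟨ Δ₁⊗Δ≡swap (suc j) x y ⟩
    swap (suc j) (swap 1 P) g
      ≡⟨ swap-swap₁ j P g ⟩
    K * K * swap (suc (suc j)) P g + ι (suc j) * (excess g + K) * swap (suc j) P g
      ≡⟨ cong₂ (λ s t → K * K * s + t) (sym (Δ≡swap (suc (suc j)) x y))
           (cong₂ (λ s t → ι (suc j) * (s + K) * t)
             (trans (excess≡ g) (cong (λ c → ι (length (slots n) ℕ.∸ c) - ι c) (card-reps y)))
             (sym (Δ≡swap (suc j) x y))) ⟩
    K * K * Δ reps (suc (suc j)) x y + slope j * Δ reps (suc j) x y ∎
    where
    open ≡-Reasoning
    P = isoTo x ∘ graph
    g = vec (reps y)
    K = ι (suc (suc j))

-- Combinations of positive powers of a matrix

InSpan : ∀ {k} → Matrix k → ℕ → Matrix k → Set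
InSpan A i M = ∃ λ (c : Fin i → ℚ) → ∀ x y → M x y ≡ sumℚ (λ j → c j * (A ^[1+ toℕ j ]) x y)

-- The exponents 1 to `i` become 2 to `suc i`, so `A` itself receives the coefficient 0.
span-mult : ∀ {A : Matrix k} {i M} → InSpan A i M → InSpan A (suc i) (A ⊗ M)
span-mult {A = A} {i} {M} (c , eq) = (λ { zero → 0ℚ ; (suc j) → c j }) , λ x y → begin
  sumℚ (λ z → A x z * M z y)
    ≡⟨ trans (sumℚ≡sum (λ z → A x z * M z y)) (sum-cong-≗ λ z → cong (A x z *_) (trans (eq z y) (sumℚ≡sum (λ j → c j * pow j z y)))) ⟩
  sum (λ z → A x z * sum (λ j → c j * pow j z y))
    ≡⟨ sum-cong-≗ (λ z → *-distribˡ-sum (A x z) (λ j → c j * pow j z y)) ⟩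
  sum (λ z → sum (λ j → A x z * (c j * pow j z y)))
    ≡⟨ ∑-comm (λ z j → A x z * (c j * pow j z y)) ⟩
  sum (λ j → sum (λ z → A x z * (c j * pow j z y)))
    ≡⟨ sum-cong-≗ (λ j → trans
         (sum-cong-≗ λ z → solve 3 (λ a c b → a :* (c :* b) := c :* (a :* b)) refl (A x z) (c j) (pow j z y))
         (trans (sym (*-distribˡ-sum (c j) (λ z → A x z * pow j z y))) (cong (c j *_) (sym (sumℚ≡sum (λ z → A x z * pow j z y)))))) ⟩
  sum (λ j → c j * (A ⊗ pow j) x y)
    ≡⟨ sumℚ≡sum (λ j → c j * (A ⊗ pow j) x y) ⟨
  sumℚ (λ j → c j * (A ⊗ pow j) x y)
    ≡⟨ trans (cong (_+ sumℚ (λ j → c j * (A ⊗ pow j) x y)) (*-zeroˡ (A x y))) (+-identityˡ _) ⟨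
  0ℚ * A x y + sumℚ (λ j → c j * (A ⊗ pow j) x y) ∎
  where
  open ≡-Reasoning
  pow : Fin i → Matrix _
  pow j = A ^[1+ toℕ j ]

-- The new zero sits at the highest exponent, so the old coefficients keep their powers.
extend : ∀ {i} → (Fin i → ℚ) → Fin (suc i) → ℚ
extend {zero}  c _       = 0ℚ
extend {suc i} c zero    = c zero
extend {suc i} c (suc j) = extend (c ∘ suc) j

sum-extend : ∀ {i} (c : Fin i → ℚ) (u : ℕ → ℚ) → sumℚ (λ j → extend c j * u (toℕ j)) ≡ sumℚ (λ j → c j * u (toℕ j))
sum-extend {zero}  c u = trans (+-identityʳ (0ℚ * u 0)) (*-zeroˡ (u 0))
sum-extend {suc i} c u = cong (c zero * u 0 +_) (sum-extend (c ∘ suc) (u ∘ suc))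

span-weaken : ∀ {A : Matrix k} {i M} → InSpan A i M → InSpan A (suc i) M
span-weaken {A = A} (c , eq) = extend c , λ x y → trans (eq x y) (sym (sum-extend c (λ j → (A ^[1+ j ]) x y)))

span-linear : ∀ {A : Matrix k} {i M M′} p q → InSpan A i M → InSpan A i M′ → InSpan A i (λ x y → p * M x y + q * M′ x y)
span-linear {A = A} {i} {M} {M′} p q (c , eq) (c′ , eq′) = (λ j → p * c j + q * c′ j) , λ x y →
  let pow = λ (j : Fin i) → (A ^[1+ toℕ j ]) x y in begin
  p * M x y + q * M′ x y
    ≡⟨ cong₂ (λ s t → p * s + q * t) (trans (eq x y) (sumℚ≡sum (λ j → c j * pow j))) (trans (eq′ x y) (sumℚ≡sum (λ j → c′ j * pow j))) ⟩
  p * sum (λ j → c j * pow j) + q * sum (λ j → c′ j * pow j)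
    ≡⟨ cong₂ _+_ (*-distribˡ-sum p (λ j → c j * pow j)) (*-distribˡ-sum q (λ j → c′ j * pow j)) ⟩
  sum (λ j → p * (c j * pow j)) + sum (λ j → q * (c′ j * pow j))
    ≡⟨ ∑-distrib-+ (λ j → p * (c j * pow j)) (λ j → q * (c′ j * pow j)) ⟨
  sum (λ j → p * (c j * pow j) + q * (c′ j * pow j))
    ≡⟨ sum-cong-≗ (λ j → solve 5 (λ p c q c′ b → p :* (c :* b) :+ q :* (c′ :* b) := (p :* c :+ q :* c′) :* b) refl p (c j) q (c′ j) (pow j)) ⟩
  sum (λ j → (p * c j + q * c′ j) * pow j)
    ≡⟨ sumℚ≡sum (λ j → (p * c j + q * c′ j) * pow j) ⟨
  sumℚ (λ j → (p * c j + q * c′ j) * pow j) ∎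
  where open ≡-Reasoning

span-resp : ∀ {A : Matrix k} {i M M′} → (∀ x y → M x y ≡ M′ x y) → InSpan A i M → InSpan A i M′
span-resp M≡ (c , eq) = c , λ x y → trans (sym (M≡ x y)) (eq x y)

-- The induction starts at Δ_1, not at the identity Δ_0, and both terms of the recurrence stay among
-- positive powers.
Δ-inSpan : ∀ {n m k} {reps : Fin k → Graph n} → IsoClassEnum n m reps → ∀ j → InSpan (Δ reps 1) (suc j) (Δ reps (suc j))
Δ-inSpan {reps = reps} enum zero = (λ _ → 1ℚ) , λ x y → sym (trans (+-identityʳ (1ℚ * Δ reps 1 x y)) (*-identityˡ (Δ reps 1 x y)))
Δ-inSpan {reps = reps} enum (suc j) = span-resp solved
  -- These coefficients solve the recurrence for its leading term, whose factor `K * K` is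
  -- invertible over the rationals.
  (span-linear (r * r) (- (r * r * slope enum j)) (span-mult (Δ-inSpan enum j)) (span-weaken (Δ-inSpan enum j)))
  where
  open ≡-Reasoning
  K = ι (suc (suc j))
  instance
    K≢0 : ℚ.NonZero K
    K≢0 = ≢-nonZero (ι-suc≢0 (suc j))
  r = 1/ K
  solved : ∀ x y → r * r * (Δ reps 1 ⊗ Δ reps (suc j)) x y + - (r * r * slope enum j) * Δ reps (suc j) x y ≡ Δ reps (suc (suc j)) x y
  solved x y = begin
    r * r * (Δ reps 1 ⊗ Δ reps (suc j)) x y + - (r * r * s) * d
      ≡⟨ cong (λ t → r * r * t + - (r * r * s) * d) (Δ₁⊗Δ enum j x y) ⟩
    r * r * (K * K * e + s * d) + - (r * r * s) * d
      ≡⟨ solve 5 (λ r K e s d → r :* r :* (K :* K :* e :+ s :* d) :+ (:- (r :* r :* s)) :* d := (r :* K) :* (r :* K) :* e) refl r K e s d ⟩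
    (r * K) * (r * K) * e
      ≡⟨ cong (λ t → t * t * e) (*-inverseˡ K) ⟩
    1ℚ * 1ℚ * e
      ≡⟨ *-identityˡ e ⟩
    e ∎
    where
    s = slope enum j
    d = Δ reps (suc j) x y
    e = Δ reps (suc (suc j)) x y

theorem2p4 : (n m : ℕ) → n ≥ 1 → m ≤ n C 2 →
    (i : ℕ) → i ≥ 1 →
    (k : ℕ) (reps : Fin k → Graph n) → IsoClassEnum n m reps →
    ∃ λ (c : Fin i → ℚ) →
    ∀ x y → Δ reps i x y ≡ sumℚ (λ j → c j * ((Δ reps 1) ^[1+ toℕ j ]) x y)
theorem2p4 n m _ _ (suc i) _ k reps enum = Δ-inSpan enum i
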